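{- Let $n$ be a positive integer, let $\mathcal B\subseteq\mathcal P([n])$ be a simply rooted family with $|\mathcal B|=m$, and let $p\in[0,1]$. Suppose that $|\mathcal B_{\{i\}}|\le pm$ for all $i\in[n]$. Then \[ \|\mathcal B\|\le \|\mathcal I(m)\|+m-\frac{m^2(1/12-p^2/12)}{2^n}. \]
   Context: A family $\mathcal B\subseteq\mathcal P([n])$ is simply rooted if for every nonempty $B\in\mathcal B$ there is $b\in B$ with $[\{b\},B]:=\{C:\{b\}\subseteq C\subseteq B\}\subseteq\mathcal B$. For $B\in\mathcal B$ and $i\in[n]$, $B$ is $\mathcal B$-rooted at $i$ if $i\in B$ and $[\{i\},B]\subseteq\mathcal B$. For $S\subseteq[n]$, $\mathcal B_S$ is the family of sets of $\mathcal B$ that are $\mathcal B$-rooted at some $i\in S$. For a finite family $\mathcal F$ of finite sets, $\|\mathcal F\|=\sum_{F\in\mathcal F}|F|$. The colex order on finite sets of positive integers: $A<B$ iff $\max(A\triangle B)\in B$; $\mathcal I(m)$ is the family of the first $m$ sets in this order.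
   Formalization: The parameter p in [0,1] is taken to be rational rather than real; the real case follows, since the least admissible p, the maximum of |B_{i}|/m, is rational and the bound weakens as p grows. -}

module Defs where

open import Data.Nat as ℕ using (ℕ; zero; suc; _<_)
open import Data.Nat.Properties using (m^n≢0)
open import Data.Integer using (+_)
open import Data.Rational using (ℚ; _/_)
open import Data.Bool.Properties using () renaming (_≟_ to _≟𝔹_)
open import Data.Vec.Properties using (≡-dec)
open import Data.Fin using (Fin)
open import Data.Fin.Subset using (Subset; _∈_; _∉_; _⊆_; ∣_∣; Nonempty)
open import Data.Fin.Subset.Properties using (_∈?_; _⊆?_; anySubset?)
open import Data.List using (List; length; filter; map)
open import Data.Nat.ListAction using (sum)
import Data.List.Membership.Propositional as LMem
import Data.List.Membership.DecPropositional as LDec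
open import Data.List.Relation.Unary.Unique.Propositional using (Unique)
open import Data.List.Relation.Unary.All using (All)
open import Data.List.Relation.Unary.Linked using (Linked)
open import Data.Product using (∃; _×_; _,_)
open import Data.Sum using (_⊎_)
open import Data.Empty using (⊥-elim)
open import Relation.Nullary using (Dec; yes; no; ¬_; _×-dec_)
open import Relation.Nullary.Decidable using (decidable-stable; ¬?)
open import Relation.Binary.PropositionalEquality using (_≡_)
open import Function.Bundles using (_⇔_)

-- Families of subsets of [n] = Fin n: a family is a duplicate-free list
-- of subsets (Subset n = Vec Bool n, a canonical representation).

Family : ℕ → Set
Family n = List (Subset n)

_∈ℱ_ : ∀ {n} → Subset n → Family n → Set
C ∈ℱ ℬ = C LMem.∈ ℬ

_∈ℱ?_ : ∀ {n} (C : Subset n) (ℬ : Family n) → Dec (C ∈ℱ ℬ)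
_∈ℱ?_ {n} C ℬ = LDec._∈?_ (≡-dec _≟𝔹_) C ℬ

IntervalIn : ∀ {n} → Family n → Fin n → Subset n → Set
IntervalIn {n} ℬ i B = (C : Subset n) → i ∈ C → C ⊆ B → C ∈ℱ ℬ

RootedAt : ∀ {n} → Family n → Fin n → Subset n → Set
RootedAt ℬ i B = i ∈ B × IntervalIn ℬ i B

SimplyRooted : ∀ {n} → Family n → Set
SimplyRooted ℬ = ∀ B → B ∈ℱ ℬ → Nonempty B → ∃ λ b → RootedAt ℬ b B

private
  Q? : ∀ {n} (ℬ : Family n) (i : Fin n) (B C : Subset n) → Dec (i ∈ C → C ⊆ B → C ∈ℱ ℬ)
  Q? ℬ i B C with i ∈? C | C ⊆? B | C ∈ℱ? ℬ
  ... | _     | _     | yes c = yes (λ _ _ → c)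
  ... | no ¬a | _     | no _  = yes (λ a _ → ⊥-elim (¬a a))
  ... | yes _ | no ¬s | no _  = yes (λ _ s → ⊥-elim (¬s s))
  ... | yes a | yes s | no ¬c = no (λ f → ¬c (f a s))

IntervalIn? : ∀ {n} (ℬ : Family n) (i : Fin n) (B : Subset n) → Dec (IntervalIn ℬ i B)
IntervalIn? {n} ℬ i B with anySubset? (λ C → ¬? (Q? ℬ i B C))
... | yes (C , ¬q) = no (λ f → ¬q (f C))
... | no h = yes (λ C a s → decidable-stable (C ∈ℱ? ℬ) (λ ¬c → h (C , λ f → ¬c (f a s))))

RootedAt? : ∀ {n} (ℬ : Family n) (i : Fin n) (B : Subset n) → Dec (RootedAt ℬ i B)
RootedAt? ℬ i B = (i ∈? B) ×-dec IntervalIn? ℬ i B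

ℬ[_] : ∀ {n} → Family n → Fin n → Family n
ℬ[ ℬ ] i = filter (RootedAt? ℬ i) ℬ

‖_‖ : ∀ {n} → Family n → ℕ
‖ ℬ ‖ = sum (map ∣_∣ ℬ)

-- Finite sets of positive integers, canonically represented as strictly
-- increasing lists of positive naturals.

_∈ℕ_ : ℕ → List ℕ → Set
x ∈ℕ A = x LMem.∈ A

CanonicalSet : List ℕ → Set
CanonicalSet A = Linked _<_ A × All (λ x → 1 ℕ.≤ x) A

-- colex: A <colex B iff max(A △ B) ∈ B, i.e. there is x ∈ B \ A such that
-- A and B agree on all elements larger than x.
_<colex_ : List ℕ → List ℕ → Set
A <colex B = ∃ λ x → x ∈ℕ B × ¬ (x ∈ℕ A) × (∀ y → x < y → (y ∈ℕ A ⇔ y ∈ℕ B))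

-- 𝓘 is (a listing of) the family 𝓘(m) of the first m finite sets of
-- positive integers in colex order: m distinct finite sets, closed
-- downward under the colex order.
IsColexInitial : ℕ → List (List ℕ) → Set
IsColexInitial m 𝓘 =
  length 𝓘 ≡ m × Unique 𝓘 × All CanonicalSet 𝓘 ×
  (∀ A B → CanonicalSet A → B LMem.∈ 𝓘 → A <colex B → A LMem.∈ 𝓘)

‖_‖ℕ : List (List ℕ) → ℕ
‖ 𝓘 ‖ℕ = sum (map length 𝓘)

inv2^ : ℕ → ℚ
inv2^ n = (+ 1) / (2 ℕ.^ n)
  where instance _ = m^n≢0 2 n

{-# OPTIONS --safe #-}

-- Let E(m) = ‖𝓘(m)‖, the number of edges of the cube spanned by the first m sets in colex order.
-- A set rooted at b has all its lower neighbours in the family, except possibly the one without b;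
-- the edge-isoperimetric inequality then gives ‖ℬ‖ ≤ E(m) + m, and each "full" set (one whose
-- subsets all lie in the family) saves 1.
--
-- Split [n] = S ⊔ T, and let X and Y be the sets of ℬ rooted at a point of S and of T, with the full
-- ones added to both. Compressing ℬ down along every point of S decreases the norm by the number of
-- moved sets, and each moved set becomes full at a position outside ℬ ⊇ Y. The compressed family 𝒢
-- contains Y and the compression of X, and the latter is a down-set, so 𝒢 has at least |X| full sets.
-- The full sets lying in Y cost nothing at either stage, so ‖ℬ‖ ≤ E(m) + m − |Y ∩ full 𝒢|, and a
-- Kleitman-type correlation inequality gives |Y ∩ full 𝒢| ≥ |X| |Y| / 2ⁿ.
--
-- As |ℬ_{i}| ≤ pm for each i, some prefix S of [n] makes X and Y balanced: 4 |X| |Y| ≥ (1 − p) m².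

module Submission where

open import Defs

module CubeFamilies where

  open import Data.Nat
    using (ℕ; zero; suc; _+_; _*_; _^_; _≤_; _<_; _⊓_; _≤?_; _<?_; _≤‴_; ≤‴-refl; ≤‴-step; z≤n; s≤s; NonZero)
  open import Data.Nat.Properties hiding (_≟_)
  open import Data.Nat.ListAction using (sum)
  open import Data.Nat.ListAction.Properties using (sum-++)
  open import Data.Nat.Tactic.RingSolver using (solve-∀)
  open import Data.Bool using (Bool; true; false; _∧_; _∨_; not)
  open import Data.Bool.Properties using () renaming (_≟_ to _≟ᵇ_)
  open import Data.Fin using (Fin; zero; suc; toℕ; fromℕ<)
  open import Data.Fin.Properties using (_≟_; any?; toℕ<n; fromℕ<-toℕ; fromℕ<-cong)
  open import Data.Fin.Subset using (Subset; _∈_; _∉_; _⊆_; ∣_∣)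
  open import Data.Fin.Subset.Properties
    using (_∈?_; _⊆?_; anySubset?; nonempty?; Empty-unique; drop-∷-⊆; out⊆; s⊆s; ⊆-refl; ⊆-trans)
  open import Data.List using (List; []; _∷_; _++_; length; map; filter; allFin)
  open import Data.List.Properties using (map-++) renaming (≡-dec to List-≡-dec)
  import Data.List.Membership.Propositional as LMem
  open import Data.List.Membership.Propositional.Properties
    using (∈-filter⁺; ∈-filter⁻; ∈-allFin; ∈-∃++; ∈-++⁻; ∈-++⁺ˡ; ∈-++⁺ʳ)
  open import Data.List.Membership.DecPropositional (List-≡-dec Data.Nat.Properties._≟_)
    using () renaming (_∈?_ to _∈𝓘?_)
  open import Data.List.Relation.Unary.All as All using (All; []; _∷_)
  open import Data.List.Relation.Unary.AllPairs using (AllPairs; []; _∷_)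
  open import Data.List.Relation.Unary.Any using (here; there)
  open import Data.List.Relation.Unary.Linked.Properties using (AllPairs⇒Linked; Linked⇒AllPairs)
  open import Data.List.Relation.Unary.Unique.Propositional using (Unique)
  open import Data.List.Relation.Unary.Unique.Propositional.Properties using (filter⁺)
  open import Data.Maybe using (Maybe; just; nothing)
  open import Data.Maybe.Properties using (just-injective)
  open import Data.Maybe.Relation.Unary.All as Maybe using (just; nothing)
  open import Data.Product using (∃; _×_; _,_; proj₁; proj₂)
  open import Data.Sum using (_⊎_; inj₁; inj₂)
  open import Data.Vec using ([]; _∷_; _[_]≔_; lookup; here; there)
  open import Data.Vec.Properties
    using ([]≔-updates; []≔-minimal; []≔-idempotent; []≔-commutes; []≔-lookup; lookup∘updateAt;
           []=⇒lookup; lookup⇒[]=; []=-injective)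
    renaming (≡-dec to Vec-≡-dec)
  open import Function using (_∘_; case_of_)
  open import Function.Bundles using (_⇔_; mk⇔; Equivalence)
  open import Relation.Binary.Definitions using (tri<; tri≈; tri>)
  open import Relation.Binary.PropositionalEquality
    using (_≡_; _≢_; refl; sym; trans; cong; cong₂; subst; subst₂)
  open import Relation.Nullary
    using (Dec; yes; no; ¬_; does; contradiction; _→-dec_; _×-dec_; _⊎-dec_; map′)
  open import Relation.Nullary.Decidable using (decidable-stable; ¬?; dec-true; dec-false)

  private variable
    n : ℕ

  -- Sums over all subsets of [n]

  ∑ : (Subset n → ℕ) → ℕ
  ∑ {zero}  f = f []
  ∑ {suc n} f = ∑ (f ∘ (false ∷_)) + ∑ (f ∘ (true ∷_))

  ∑-mono : {f g : Subset n → ℕ} → (∀ A → f A ≤ g A) → ∑ f ≤ ∑ g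
  ∑-mono {zero}  h = h []
  ∑-mono {suc n} h = +-mono-≤ (∑-mono (h ∘ (false ∷_))) (∑-mono (h ∘ (true ∷_)))

  ∑-cong : {f g : Subset n → ℕ} → (∀ A → f A ≡ g A) → ∑ f ≡ ∑ g
  ∑-cong h = ≤-antisym (∑-mono (≤-reflexive ∘ h)) (∑-mono (≤-reflexive ∘ sym ∘ h))

  ∑-+ : (f g : Subset n → ℕ) → ∑ (λ A → f A + g A) ≡ ∑ f + ∑ g
  ∑-+ {zero}  f g = refl
  ∑-+ {suc n} f g = trans
    (cong₂ _+_ (∑-+ (f ∘ (false ∷_)) (g ∘ (false ∷_))) (∑-+ (f ∘ (true ∷_)) (g ∘ (true ∷_))))
    (interchange (∑ (f ∘ (false ∷_))) _ _ _)
    where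
    interchange : ∀ a b c d → (a + b) + (c + d) ≡ (a + c) + (b + d)
    interchange = solve-∀

  ∑-zero : ∑ {n} (λ _ → 0) ≡ 0
  ∑-zero {zero}  = refl
  ∑-zero {suc n} = cong₂ _+_ (∑-zero {n}) (∑-zero {n})

  ∑-+-mono : (f g h k : Subset n → ℕ) → (∀ A → f A + g A ≤ h A + k A) → ∑ f + ∑ g ≤ ∑ h + ∑ k
  ∑-+-mono f g h k le = subst₂ _≤_ (∑-+ f g) (∑-+ h k) (∑-mono le)

  -- The cube splits into pairs of sets that differ only in `k`. Compression along `k` acts inside
  -- these pairs, so its effect on a sum can be checked pair by pair.
  ∑-pairs : (k : Fin n) {f g : Subset n → ℕ} →
    (∀ A → f (A [ k ]≔ false) + f (A [ k ]≔ true) ≤ g (A [ k ]≔ false) + g (A [ k ]≔ true)) →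
    ∑ f ≤ ∑ g
  ∑-pairs zero {f} {g} h =
    ∑-+-mono (f ∘ (false ∷_)) (f ∘ (true ∷_)) (g ∘ (false ∷_)) (g ∘ (true ∷_)) (h ∘ (false ∷_))
  ∑-pairs (suc k) h = +-mono-≤ (∑-pairs k (h ∘ (false ∷_))) (∑-pairs k (h ∘ (true ∷_)))

  -- Families, their size and their norm

  Fam : ℕ → Set
  Fam n = Subset n → Bool

  _∋_ : Fam n → Subset n → Set
  F ∋ A = F A ≡ true

  _⊑_ : Fam n → Fam n → Set
  F ⊑ G = ∀ A → F ∋ A → G ∋ A

  _∩_ _∪_ _∖_ : Fam n → Fam n → Fam n
  (F ∩ G) A = F A ∧ G A
  (F ∪ G) A = F A ∨ G A
  (F ∖ G) A = F A ∧ not (G A)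

  _↾_ : Fam (suc n) → Bool → Fam n
  (F ↾ b) A = F (b ∷ A)

  ind : Bool → ℕ
  ind false = 0
  ind true  = 1

  count : Fam n → ℕ
  count F = ∑ (ind ∘ F)

  norm : Fam n → ℕ
  norm F = ∑ (λ A → ind (F A) * ∣ A ∣)

  ind-mono : ∀ {a b} → (a ≡ true → b ≡ true) → ind a ≤ ind b
  ind-mono {false} h = z≤n
  ind-mono {true}  h rewrite h refl = s≤s z≤n

  count-mono : {F G : Fam n} → F ⊑ G → count F ≤ count G
  count-mono h = ∑-mono (λ A → ind-mono (h A))

  ∧-true : ∀ {a b} → a ∧ b ≡ true → a ≡ true × b ≡ true
  ∧-true {true} {true} _ = refl , refl

  ∨-true : ∀ {a b} → a ∨ b ≡ true → a ≡ true ⊎ b ≡ true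
  ∨-true {true}  _ = inj₁ refl
  ∨-true {false} p = inj₂ p

  ∨-introʳ : ∀ a {b} → b ≡ true → a ∨ b ≡ true
  ∨-introʳ false p = p
  ∨-introʳ true  p = refl

  ∧-intro : ∀ {a b} → a ≡ true → b ≡ true → a ∧ b ≡ true
  ∧-intro refl refl = refl

  does-true : ∀ {ℓ} {P : Set ℓ} (d : Dec P) → does d ≡ true → P
  does-true (yes p) _ = p

  -- Adding and removing a point

  module _ {k : Fin n} where

    ≔-∉ : {A : Subset n} → k ∉ A [ k ]≔ false
    ≔-∉ {A} p with () ← []=-injective p ([]≔-updates A k)

    ≔-⊆⁻ : ∀ {b i} {A : Subset n} → i ≢ k → i ∈ A [ k ]≔ b → i ∈ A
    ≔-⊆⁻ {b} {i} {A} i≢k p with i ∈? A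
    ... | yes q = q
    ... | no ¬q with lookup A i in eq
    ... | true  = contradiction (lookup⇒[]= i A eq) ¬q
    ... | false with () ← []=-injective p ([]≔-minimal A i k i≢k (lookup⇒[]= i A eq))

    ≔-⊆ : {A : Subset n} → A [ k ]≔ false ⊆ A
    ≔-⊆ {A} {i} p with i ≟ k
    ... | yes refl = contradiction p (≔-∉ {A})
    ... | no  i≢k  = ≔-⊆⁻ i≢k p

    ⊆-≔ : {A : Subset n} → A ⊆ A [ k ]≔ true
    ⊆-≔ {A} {i} p with i ≟ k
    ... | yes refl = []≔-updates A k
    ... | no  i≢k  = []≔-minimal A i k i≢k p

    ≔-mono : ∀ {b} {A C : Subset n} → C ⊆ A → C [ k ]≔ b ⊆ A [ k ]≔ b
    ≔-mono {b} {A} {C} C⊆A {i} p with i ≟ k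
    ... | no i≢k   = []≔-minimal A i k i≢k (C⊆A (≔-⊆⁻ i≢k p))
    ≔-mono {true}  {A} C⊆A p | yes refl = []≔-updates A k
    ≔-mono {false} {C = C} C⊆A p | yes refl = contradiction p (≔-∉ {C})

    ≔-id : ∀ {b} {A : Subset n} → lookup A k ≡ b → A [ k ]≔ b ≡ A
    ≔-id {A = A} refl = []≔-lookup A k

  -- A label is a point, or `nothing`, which counts as a member of every set: a set is rooted by
  -- `nothing` when all its subsets are in the family.

  Label : ℕ → Set
  Label n = Maybe (Fin n)

  _∈ₗ_ : Label n → Subset n → Set
  ℓ ∈ₗ A = Maybe.All (_∈ A) ℓ

  module _ {k : Fin n} {b : Bool} {A : Subset n} where

    ∈ₗ-≔⁺ : {ℓ : Label n} → ℓ ≢ just k → ℓ ∈ₗ A → ℓ ∈ₗ (A [ k ]≔ b)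
    ∈ₗ-≔⁺ ℓ≢k nothing            = nothing
    ∈ₗ-≔⁺ ℓ≢k (just {x = j} j∈A) = just ([]≔-minimal A j k (ℓ≢k ∘ cong just) j∈A)

    ∈ₗ-≔⁻ : {ℓ : Label n} → ℓ ≢ just k → ℓ ∈ₗ (A [ k ]≔ b) → ℓ ∈ₗ A
    ∈ₗ-≔⁻ ℓ≢k nothing    = nothing
    ∈ₗ-≔⁻ ℓ≢k (just j∈A) = just (≔-⊆⁻ (ℓ≢k ∘ cong just) j∈A)

  label≟ : (ℓ : Label n) (k : Fin n) → Dec (ℓ ≡ just k)
  label≟ nothing  k = no λ ()
  label≟ (just j) k = map′ (cong just) just-injective (j ≟ k)

  RootedBy : Fam n → Label n → Subset n → Set
  RootedBy F ℓ A = ℓ ∈ₗ A × (∀ C → ℓ ∈ₗ C → C ⊆ A → F ∋ C)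

  Rooted : Fam n → Set
  Rooted F = ∀ A → F ∋ A → ∃ λ ℓ → RootedBy F ℓ A

  rooted-∋ : {F : Fam n} {ℓ : Label n} {A : Subset n} → RootedBy F ℓ A → F ∋ A
  rooted-∋ {A = A} (ℓ∈A , h) = h A ℓ∈A ⊆-refl

  allSubsets? : {P : Subset n → Set} → (∀ A → Dec (P A)) → Dec (∀ A → P A)
  allSubsets? P? with anySubset? (¬? ∘ P?)
  ... | yes (A , ¬p) = no (λ h → ¬p (h A))
  ... | no h = yes (λ A → decidable-stable (P? A) (λ ¬p → h (A , ¬p)))

  rootedBy? : (F : Fam n) (ℓ : Label n) (A : Subset n) → Dec (RootedBy F ℓ A)
  rootedBy? F ℓ A = Maybe.dec (_∈? A) ℓ ×-dec
    allSubsets? (λ C → Maybe.dec (_∈? C) ℓ →-dec (C ⊆? A →-dec F C ≟ᵇ true))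

  full : Fam n → Fam n
  full F A = does (rootedBy? F nothing A)

  full⁺ : (F : Fam n) {A : Subset n} → RootedBy F nothing A → full F ∋ A
  full⁺ F {A} = dec-true (rootedBy? F nothing A)

  full⁻ : {F : Fam n} {A : Subset n} → full F ∋ A → ∀ {C} → C ⊆ A → F ∋ C
  full⁻ {F = F} {A} p {C} = proj₂ (does-true (rootedBy? F nothing A) p) C nothing

  full⊑ : (F : Fam n) → full F ⊑ F
  full⊑ F A p = full⁻ {F = F} p ⊆-refl

  Closed : Fin n → Fam n → Set
  Closed k F = ∀ A → F ∋ A → F ∋ (A [ k ]≔ false)

  -- The coordinates are settled one at a time from the head: the head of `A` is removed if `C`
  -- lacks it, and the rest takes place in the section given by the head of `C`.
  closed-⊆ : {F : Fam n} → (∀ k → Closed k F) → ∀ {A C} → F ∋ A → C ⊆ A → F ∋ C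
  closed-⊆ {zero} c {[]} {[]} p _ = p
  closed-⊆ {suc n} {F} c {a ∷ A} {b ∷ C} p C⊆A =
    closed-⊆ {F = F ↾ b} (λ k → c (suc k) ∘ (b ∷_)) {A} (head a b p C⊆A) (drop-∷-⊆ C⊆A)
    where
    head : ∀ a b → F ∋ (a ∷ A) → b ∷ C ⊆ a ∷ A → F ∋ (b ∷ A)
    head false false p _ = p
    head true  true  p _ = p
    head true  false p _ = c zero _ p
    head false true  p s with () ← s here

  full-closed : (F : Fam n) (k : Fin n) → Closed k (full F)
  full-closed F k A p = full⁺ F (nothing , λ C _ s → full⁻ {F = F} p (⊆-trans s (≔-⊆ {A = A})))

  -- Compression

  -- Every A with k ∈ A is replaced by A ∖ {k}, unless the latter is already present.
  compress : Fin n → Fam n → Fam n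
  compress k F A = (F A ∧ F (A [ k ]≔ false)) ∨ (not (lookup A k) ∧ F (A [ k ]≔ true))

  module _ {k : Fin n} (F : Fam n) where

    compress⁺ : ∀ {A} → F ∋ A → F ∋ (A [ k ]≔ false) → compress k F ∋ A
    compress⁺ p q rewrite p | q = refl

    compress-moved⁺ : ∀ {A} → k ∉ A → F ∋ (A [ k ]≔ true) → compress k F ∋ A
    compress-moved⁺ {A} k∉A p with lookup A k in eq
    ... | true  = contradiction (lookup⇒[]= k A eq) k∉A
    ... | false = ∨-introʳ (F A ∧ F (A [ k ]≔ false)) p

    compress⁻ : ∀ {A} → compress k F ∋ A →
      (F ∋ A × F ∋ (A [ k ]≔ false)) ⊎ (k ∉ A × F ∋ (A [ k ]≔ true))
    compress⁻ {A} p with ∨-true {F A ∧ F (A [ k ]≔ false)} p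
    ... | inj₁ q = inj₁ (∧-true q)
    ... | inj₂ q with lookup A k in eq
    ... | false = inj₂ ((λ k∈A → case trans (sym ([]=⇒lookup k∈A)) eq of λ ()) , q)

    -- On a pair of sets without and with `k`, compression acts as (a, b) ↦ (a ∨ b, b ∧ a). With
    -- `compress-true` this reduces statements about size and norm to finite case checks.
    compress-false : ∀ A → compress k F (A [ k ]≔ false) ≡ F (A [ k ]≔ false) ∨ F (A [ k ]≔ true)
    compress-false A rewrite lookup∘updateAt k {λ _ → false} A
      | []≔-idempotent {x = false} {y = false} A k | []≔-idempotent {x = false} {y = true} A k
      with F (A [ k ]≔ false)
    ... | false = refl
    ... | true  = refl

    compress-true : ∀ A → compress k F (A [ k ]≔ true) ≡ F (A [ k ]≔ true) ∧ F (A [ k ]≔ false)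
    compress-true A rewrite lookup∘updateAt k {λ _ → true} A
      | []≔-idempotent {x = true} {y = false} A k
      with F (A [ k ]≔ false) | F (A [ k ]≔ true)
    ... | false | false = refl
    ... | false | true  = refl
    ... | true  | false = refl
    ... | true  | true  = refl

    -- A root other than `k` survives compression: removing `k` from `C` keeps the root and stays
    -- below `A`, so `C` does not move.
    compress-label : ∀ {ℓ A} → ℓ ≢ just k → (∀ C → ℓ ∈ₗ C → C ⊆ A → F ∋ C) →
      ∀ C → ℓ ∈ₗ C → C ⊆ A → compress k F ∋ C
    compress-label ℓ≢k h C ℓ∈C C⊆A =
      compress⁺ (h C ℓ∈C C⊆A) (h _ (∈ₗ-≔⁺ ℓ≢k ℓ∈C) (⊆-trans (≔-⊆ {A = C}) C⊆A))

    full-compress : full F ⊑ full (compress k F)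
    full-compress A p = full⁺ (compress k F)
      (nothing , compress-label (λ ()) (λ C _ → full⁻ {F = F} p))

  count-compress : (k : Fin n) (F : Fam n) → count (compress k F) ≡ count F
  count-compress k F = ≤-antisym (∑-pairs k (≤-reflexive ∘ pair)) (∑-pairs k (≤-reflexive ∘ sym ∘ pair))
    where
    ∨∧ : ∀ a b → ind (a ∨ b) + ind (b ∧ a) ≡ ind a + ind b
    ∨∧ false false = refl
    ∨∧ false true  = refl
    ∨∧ true  false = refl
    ∨∧ true  true  = refl
    pair : ∀ A → ind (compress k F (A [ k ]≔ false)) + ind (compress k F (A [ k ]≔ true))
               ≡ ind (F (A [ k ]≔ false)) + ind (F (A [ k ]≔ true))
    pair A rewrite compress-false {k = k} F A | compress-true {k = k} F A = ∨∧ (F (A [ k ]≔ false)) _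

  compress-mono : (k : Fin n) {F G : Fam n} → F ⊑ G → compress k F ⊑ compress k G
  compress-mono k {F} {G} F⊑G A p with compress⁻ F p
  ... | inj₁ (q , r)   = compress⁺ G (F⊑G _ q) (F⊑G _ r)
  ... | inj₂ (k∉A , q) = compress-moved⁺ G k∉A (F⊑G _ q)

  -- Keeps `Y` inside the family during the compressions: a set whose copy without `k` is already
  -- present stays where it is.
  closed-⊑-compress : {k : Fin n} {F G : Fam n} → Closed k F → F ⊑ G → F ⊑ compress k G
  closed-⊑-compress {G = G} c F⊑G A p = compress⁺ G (F⊑G A p) (F⊑G _ (c A p))

  compress-closed : (k : Fin n) (F : Fam n) → Closed k (compress k F)
  compress-closed k F A p rewrite compress-false {k = k} F A with compress⁻ F p
  ... | inj₁ (_ , r) rewrite r = refl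
  ... | inj₂ (_ , r) = ∨-introʳ (F (A [ k ]≔ false)) r

  compress-preserves-closed : (j k : Fin n) {F : Fam n} → Closed j F → Closed j (compress k F)
  compress-preserves-closed j k {F} c A p with j ≟ k
  ... | yes refl = compress-closed k F A p
  ... | no j≢k with compress⁻ F p
  ... | inj₁ (q , r) = compress⁺ F (c A q)
          (subst (F ∋_) ([]≔-commutes A k j (j≢k ∘ sym)) (c _ r))
  ... | inj₂ (k∉A , q) = compress-moved⁺ F (k∉A ∘ ≔-⊆ {A = A})
          (subst (F ∋_) ([]≔-commutes A k j (j≢k ∘ sym)) (c _ q))

  module _ {k : Fin n} (F : Fam n) where

    -- For every `C ⊆ A`, the set `C` with `k` added lies between {k} and `A` with `k` added, hence
    -- in `F`; compression then puts `C` into the family.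
    compress-moved-full : ∀ {A} → k ∉ A → RootedBy F (just k) (A [ k ]≔ true) →
      full (compress k F) ∋ A
    compress-moved-full {A} k∉A (_ , h) = full⁺ (compress k F) (nothing , λ C _ C⊆A →
      compress-moved⁺ F (k∉A ∘ C⊆A) (h _ (just ([]≔-updates C k)) (≔-mono C⊆A)))

    compress-rooted : Rooted F → Rooted (compress k F)
    compress-rooted rF A p with compress⁻ F p
    compress-rooted rF A p | inj₂ (k∉A , q) with rF _ q
    ... | ℓ , ℓ∈ , h with label≟ ℓ k
    ... | yes refl = nothing , nothing , λ C _ → full⁻ {F = compress k F} (compress-moved-full k∉A (ℓ∈ , h))
    ... | no  ℓ≢k  = ℓ , ∈ₗ-≔⁻ ℓ≢k ℓ∈ ,
          compress-label F ℓ≢k (λ C ℓ∈C C⊆A → h C ℓ∈C (⊆-trans C⊆A (⊆-≔ {A = A})))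
    compress-rooted rF A p | inj₁ (q , r) with rF _ q
    ... | ℓ , ℓ∈ , h with label≟ ℓ k
    ... | no  ℓ≢k  = ℓ , ℓ∈ , compress-label F ℓ≢k h
    -- The root `k` may be lost although `A` stays. A root `ℓ′` of `A` without `k` replaces it:
    -- below `A`, sets containing `k` are in `F` because of the root `k`, the others because of
    -- `ℓ′`.
    ... | yes refl with rF _ r
    ... | ℓ′ , ℓ′∈ , h′ = ℓ′ , weaken ℓ′∈ , compress-label F (erased ℓ′∈) mem
      where
      weaken : ∀ {ℓ} → ℓ ∈ₗ (A [ k ]≔ false) → ℓ ∈ₗ A
      weaken nothing  = nothing
      weaken (just i) = just (≔-⊆ {A = A} i)
      erased : ∀ {ℓ} → ℓ ∈ₗ (A [ k ]≔ false) → ℓ ≢ just k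
      erased (just k∈) refl = ≔-∉ {A = A} k∈
      mem : ∀ C → ℓ′ ∈ₗ C → C ⊆ A → F ∋ C
      mem C ℓ′∈C C⊆A with lookup C k in eq
      ... | true  = h C (just (lookup⇒[]= k C eq)) C⊆A
      ... | false = h′ C ℓ′∈C (subst (_⊆ A [ k ]≔ false) (≔-id eq) (≔-mono C⊆A))

  ∣≔∣ : (A : Subset n) (k : Fin n) → ∣ A [ k ]≔ true ∣ ≡ suc ∣ A [ k ]≔ false ∣
  ∣≔∣ (a     ∷ A) zero    = refl
  ∣≔∣ (false ∷ A) (suc k) = ∣≔∣ A k
  ∣≔∣ (true  ∷ A) (suc k) = cong suc (∣≔∣ A k)

  -- A set that moves is rooted by k only, so it becomes full, at a position outside F and hence outside Y.
  compress-norm : (k : Fin n) {F Y : Fam n} → Rooted F → Y ⊑ F →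
    norm F + count (full F ∖ Y) ≤ norm (compress k F) + count (full (compress k F) ∖ Y)
  compress-norm {n} k {F} {Y} rF Y⊑F =
    subst₂ _≤_ (∑-+ (λ A → ind (F A) * ∣ A ∣) _) (∑-+ (λ A → ind (G A) * ∣ A ∣) _)
      (∑-pairs k pair)
    where
    G = compress k F

    grow : ∀ A → ind ((full F ∖ Y) A) ≤ ind ((full G ∖ Y) A)
    grow A = ind-mono {(full F ∖ Y) A}
      (λ p → case ∧-true {full F A} p of λ (q , r) → ∧-intro (full-compress F A q) r)

    -- Here `a` and `b` tell whether the sets without and with `k` lie in `F`, and `s` is the size
    -- of the former. Norm is lost only for `a = false`, `b = true`; the loss is 1 and is repaid by
    -- the strict growth from `u` to `u′`.
    trade : ∀ a b s {u v u′ v′} → u ≤ u′ → v ≤ v′ →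
      (a ≡ false → b ≡ true → suc u ≤ u′) →
      ind a * s + u + (ind b * suc s + v) ≤ ind (a ∨ b) * s + u′ + (ind (b ∧ a) * suc s + v′)
    trade false false s p q h = +-mono-≤ p q
    trade true  false s p q h = +-mono-≤ (+-monoʳ-≤ (1 * s) p) q
    trade true  true  s p q h = +-mono-≤ (+-monoʳ-≤ (1 * s) p) (+-monoʳ-≤ (1 * suc s) q)
    trade false true  s {u} {v} {u′} {v′} p q h = subst (_≤ 1 * s + u′ + v′) (move s u v)
      (+-mono-≤ (+-monoʳ-≤ (1 * s) (h refl refl)) q)
      where
      move : ∀ s u v → 1 * s + suc u + v ≡ u + (1 * suc s + v)
      move = solve-∀

    moved : ∀ A → F (A [ k ]≔ false) ≡ false → F (A [ k ]≔ true) ≡ true →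
      suc (ind ((full F ∖ Y) (A [ k ]≔ false))) ≤ ind ((full G ∖ Y) (A [ k ]≔ false))
    moved A p q with full F (A [ k ]≔ false) in eq
    ... | true  = case trans (sym p) (full⊑ F _ eq) of λ ()
    ... | false with Y (A [ k ]≔ false) in eq′
    ... | true  = case trans (sym p) (Y⊑F _ eq′) of λ ()
    ... | false with rF _ q
    ... | ℓ , ℓ∈ , h with label≟ ℓ k
    -- A root other than `k` would put the set without `k` into `F`, and nothing would move.
    ... | no ℓ≢k = case trans (sym p) (h _ (∈ₗ-≔⁺ {b = false} {A} ℓ≢k (∈ₗ-≔⁻ {A = A} ℓ≢k ℓ∈))
                         (⊆-trans (≔-⊆ {A = A}) (⊆-≔ {A = A}))) of λ ()
    ... | yes refl rewrite compress-moved-full F {A = A [ k ]≔ false} (≔-∉ {A = A})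
                     (subst (RootedBy F (just k)) (sym ([]≔-idempotent A k)) (ℓ∈ , h)) = s≤s z≤n

    pair : ∀ A →
        (ind (F (A [ k ]≔ false)) * ∣ A [ k ]≔ false ∣ + ind ((full F ∖ Y) (A [ k ]≔ false)))
      + (ind (F (A [ k ]≔ true)) * ∣ A [ k ]≔ true ∣ + ind ((full F ∖ Y) (A [ k ]≔ true)))
      ≤ (ind (G (A [ k ]≔ false)) * ∣ A [ k ]≔ false ∣ + ind ((full G ∖ Y) (A [ k ]≔ false)))
      + (ind (G (A [ k ]≔ true)) * ∣ A [ k ]≔ true ∣ + ind ((full G ∖ Y) (A [ k ]≔ true)))
    pair A rewrite compress-false {k = k} F A | compress-true {k = k} F A | ∣≔∣ A k =
      trade (F (A [ k ]≔ false)) (F (A [ k ]≔ true)) _ (grow _) (grow _) (moved A)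

  -- Compression along a list of coordinates

  -- `G` and `X′` stand for `F` and `X` after compression along `L`, while `Y` is left alone. The
  -- alternative `Closed j X` in `closed` lets the induction on `L` remember the coordinates already
  -- treated.
  record Compressed (L : List (Fin n)) (F X Y : Fam n) : Set where
    field
      G X′     : Fam n
      rooted   : Rooted G
      X′⊑G     : X′ ⊑ G
      Y⊑G      : Y ⊑ G
      count-G  : count G ≡ count F
      count-X′ : count X′ ≡ count X
      norm-G   : norm F + count (full F ∖ Y) ≤ norm G + count (full G ∖ Y)
      closed   : ∀ j → j LMem.∈ L ⊎ Closed j X → Closed j X′

  compressAll : (L : List (Fin n)) {F X Y : Fam n} → Rooted F → X ⊑ F → Y ⊑ F →
    (∀ k → k LMem.∈ L → Closed k Y) → Compressed L F X Y
  compressAll [] {F} {X} rF X⊑F Y⊑F cY = record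
    { G = F ; X′ = X ; rooted = rF ; X′⊑G = X⊑F ; Y⊑G = Y⊑F
    ; count-G = refl ; count-X′ = refl ; norm-G = ≤-refl
    ; closed = λ { j (inj₂ c) → c } }
  compressAll (k ∷ L) {F} {X} {Y} rF X⊑F Y⊑F cY = record
    { G = R.G ; X′ = R.X′ ; rooted = R.rooted ; X′⊑G = R.X′⊑G ; Y⊑G = R.Y⊑G
    ; count-G = trans R.count-G (count-compress k F)
    ; count-X′ = trans R.count-X′ (count-compress k X)
    ; norm-G = ≤-trans (compress-norm k rF Y⊑F) R.norm-G
    ; closed = λ { j (inj₁ (here refl)) → R.closed j (inj₂ (compress-closed k X))
                 ; j (inj₁ (there j∈L)) → R.closed j (inj₁ j∈L)
                 ; j (inj₂ c) → R.closed j (inj₂ (compress-preserves-closed j k c)) } }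
    where
    module R = Compressed (compressAll L (compress-rooted F rF) (compress-mono k X⊑F)
      (closed-⊑-compress (cY k (here refl)) Y⊑F) (λ j → cY j ∘ there))

  -- A correlation inequality for rooted families

  -- A condition at the root of `A` only: removing any other point from `A` cannot leave the rooted
  -- family.
  Fills : Fam n → Label n → Subset n → Set
  Fills Q ℓ A = Maybe.All (λ j → Q ∋ (A [ j ]≔ false) → Q ∋ A) ℓ

  -- The two sides differ by (a - b)(c - d).
  chebyshev : ∀ {a b c d} → b ≤ a → d ≤ c → (a + b) * (c + d) ≤ 2 * (a * c + b * d)
  chebyshev {a} {b} {c} {d} b≤a d≤c
    with e , refl ← m≤n⇒∃[o]m+o≡n b≤a | f , refl ← m≤n⇒∃[o]m+o≡n d≤c =
    subst ((b + e + b) * (d + f + d) ≤_) (identity b d e f) (m≤m+n _ (e * f))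
    where
    identity : ∀ b d e f → (b + e + b) * (d + f + d) + e * f ≡ 2 * ((b + e) * (d + f) + b * d)
    identity = solve-∀

  -- Splitting along a coordinate, Y₀ and Y₁ are replaced by the nested pair Y₀ ∪ Y₁ ⊇ Y₀ ∩ Y₁. This keeps
  -- the left-hand side, and by Fills a set of Y₁ ∖ Y₀ lies in Q₁ as soon as it lies in Q₀, so that the
  -- right-hand side does not grow.
  correlation : (Q Y : Fam n) → (∀ k → Closed k Q) →
    (∀ A → Y ∋ A → ∃ λ ℓ → RootedBy Y ℓ A × Fills Q ℓ A) →
    count Q * count Y ≤ 2 ^ n * count (Q ∩ Y)
  correlation {zero} Q Y cQ rY with Q [] | Y []
  ... | false | false = z≤n
  ... | false | true  = z≤n
  ... | true  | false = z≤n
  ... | true  | true  = s≤s z≤n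
  correlation {suc n} Q Y cQ rY = begin
    (count Q₀ + count Q₁) * (count Y₀ + count Y₁)
      ≡⟨ cong ((count Q₀ + count Q₁) *_) count-∪∩ ⟨
    (count Q₀ + count Q₁) * (count (Y₀ ∪ Y₁) + count (Y₀ ∩ Y₁))
      ≤⟨ chebyshev (count-mono (cQ zero ∘ (true ∷_))) (count-mono ∩⊑∪) ⟩
    2 * (count Q₀ * count (Y₀ ∪ Y₁) + count Q₁ * count (Y₀ ∩ Y₁))
      ≤⟨ *-monoʳ-≤ 2 (+-mono-≤
           (correlation Q₀ (Y₀ ∪ Y₁) (λ k → cQ (suc k) ∘ (false ∷_)) r∪)
           (correlation Q₁ (Y₀ ∩ Y₁) (λ k → cQ (suc k) ∘ (true ∷_)) r∩)) ⟩
    2 * (2 ^ n * count (Q₀ ∩ (Y₀ ∪ Y₁)) + 2 ^ n * count (Q₁ ∩ (Y₀ ∩ Y₁)))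
      ≡⟨ cong (2 *_) (*-distribˡ-+ (2 ^ n) _ _) ⟨
    2 * (2 ^ n * (count (Q₀ ∩ (Y₀ ∪ Y₁)) + count (Q₁ ∩ (Y₀ ∩ Y₁))))
      ≡⟨ *-assoc 2 (2 ^ n) _ ⟨
    2 ^ suc n * (count (Q₀ ∩ (Y₀ ∪ Y₁)) + count (Q₁ ∩ (Y₀ ∩ Y₁)))
      ≤⟨ *-monoʳ-≤ (2 ^ suc n) uncompress ⟩
    2 ^ suc n * count (Q ∩ Y) ∎
    where
    open ≤-Reasoning
    Q₀ = Q ↾ false
    Q₁ = Q ↾ true
    Y₀ = Y ↾ false
    Y₁ = Y ↾ true

    count-∪∩ : count (Y₀ ∪ Y₁) + count (Y₀ ∩ Y₁) ≡ count Y₀ + count Y₁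
    count-∪∩ = trans (sym (∑-+ (ind ∘ (Y₀ ∪ Y₁)) _))
      (trans (∑-cong (λ A → cell (Y₀ A) (Y₁ A))) (∑-+ (ind ∘ Y₀) _))
      where
      cell : ∀ a b → ind (a ∨ b) + ind (a ∧ b) ≡ ind a + ind b
      cell false b     = +-identityʳ (ind b)
      cell true  false = refl
      cell true  true  = refl

    ∩⊑∪ : (Y₀ ∩ Y₁) ⊑ (Y₀ ∪ Y₁)
    ∩⊑∪ A p rewrite proj₁ (∧-true {Y₀ A} p) = refl

    r∪ : ∀ A → (Y₀ ∪ Y₁) ∋ A → ∃ λ ℓ → RootedBy (Y₀ ∪ Y₁) ℓ A × Fills Q₀ ℓ A
    r∪ A p with Y₀ A in eq
    r∪ A p | true with rY (false ∷ A) eq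
    ... | nothing , (_ , h) , _ =
          nothing , (nothing , λ C _ s → cong (_∨ Y₁ C) (h _ nothing (s⊆s s))) , nothing
    ... | just zero , (just () , _) , _
    ... | just (suc j) , (just (there j∈) , h) , just f =
          just j , (just j∈ , λ { C (just i) s → cong (_∨ Y₁ C) (h _ (just (there i)) (s⊆s s)) }) , just f
    r∪ A p | false with rY (true ∷ A) p
    ... | nothing , (_ , h) , _ =
          nothing , (nothing , λ C _ s → ∨-introʳ (Y₀ C) (h _ nothing (s⊆s s))) , nothing
    -- If the head is the root, every `C ⊆ A` lies in `Y₁`, so `A` needs no root in the union.
    ... | just zero , (_ , h) , _ =
          nothing , (nothing , λ C _ s → ∨-introʳ (Y₀ C) (h _ (just here) (s⊆s s))) , nothing
    ... | just (suc j) , (just (there j∈) , h) , _ =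
          case trans (sym eq) (h (false ∷ A) (just (there j∈)) (out⊆ ⊆-refl)) of λ ()

    r∩ : ∀ A → (Y₀ ∩ Y₁) ∋ A → ∃ λ ℓ → RootedBy (Y₀ ∩ Y₁) ℓ A × Fills Q₁ ℓ A
    r∩ A p with ∧-true {Y₀ A} p
    ... | p₀ , p₁ with rY (true ∷ A) p₁
    ... | nothing , (_ , h) , _ =
          nothing , (nothing , λ C _ s → ∧-intro (h _ nothing (out⊆ s)) (h _ nothing (s⊆s s))) , nothing
    ... | just (suc j) , (just (there j∈) , h) , just f =
          just j , (just j∈ , λ { C (just i) s →
            ∧-intro (h _ (just (there i)) (out⊆ s)) (h _ (just (there i)) (s⊆s s)) }) , just f
    -- If the head is the root of the upper set, all subsets of `A` lie in `Y₁`, and a root of the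
    -- lower set serves. To fill `Q₁`, one descends to `Q₀` by closure, fills there by `f₀`, and
    -- returns to `Q₁` by `f`.
    ... | just zero , (_ , h) , just f with rY (false ∷ A) p₀
    ... | nothing , (_ , h₀) , _ =
          nothing , (nothing , λ C _ s → ∧-intro (h₀ _ nothing (s⊆s s)) (h _ (just here) (s⊆s s))) , nothing
    ... | just zero , (just () , _) , _
    ... | just (suc j) , (just (there j∈) , h₀) , just f₀ =
          just j , (just j∈ , λ { C (just i) s →
            ∧-intro (h₀ _ (just (there i)) (s⊆s s)) (h _ (just here) (s⊆s s)) }) ,
          just (f ∘ f₀ ∘ cQ zero _)

    uncompress : count (Q₀ ∩ (Y₀ ∪ Y₁)) + count (Q₁ ∩ (Y₀ ∩ Y₁)) ≤ count (Q₀ ∩ Y₀) + count (Q₁ ∩ Y₁)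
    uncompress = ∑-+-mono (ind ∘ (Q₀ ∩ (Y₀ ∪ Y₁))) (ind ∘ (Q₁ ∩ (Y₀ ∩ Y₁))) (ind ∘ (Q₀ ∩ Y₀)) (ind ∘ (Q₁ ∩ Y₁))
      (λ A → cell (Q₀ A) (Q₁ A) (Y₀ A) (Y₁ A) (lift A))
      where
      cell : ∀ q₀ q₁ y₀ y₁ → (y₀ ≡ false → y₁ ≡ true → q₀ ≡ true → q₁ ≡ true) →
        ind (q₀ ∧ (y₀ ∨ y₁)) + ind (q₁ ∧ (y₀ ∧ y₁)) ≤ ind (q₀ ∧ y₀) + ind (q₁ ∧ y₁)
      cell q₀    q₁    true  y₁    h = ≤-refl
      cell false q₁    false false h = ≤-refl
      cell true  q₁    false false h = ≤-refl
      cell false false false true  h = z≤n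
      cell false true  false true  h = z≤n
      cell true  q₁    false true  h rewrite h refl refl refl = ≤-refl

      lift : ∀ A → Y₀ A ≡ false → Y₁ A ≡ true → Q₀ A ≡ true → Q₁ A ≡ true
      lift A p₀ p₁ q₀ with rY (true ∷ A) p₁
      ... | nothing , (_ , h) , _ =
            case trans (sym p₀) (h (false ∷ A) nothing (out⊆ ⊆-refl)) of λ ()
      ... | just zero , _ , just f = f q₀
      ... | just (suc j) , (just (there j∈) , h) , _ =
            case trans (sym p₀) (h (false ∷ A) (just (there j∈)) (out⊆ ⊆-refl)) of λ ()

  -- Binary expansions, least significant bit first

  inc : List Bool → List Bool
  inc []          = true ∷ []
  inc (false ∷ b) = true ∷ b
  inc (true  ∷ b) = false ∷ inc b

  bits : ℕ → List Bool
  bits zero    = []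
  bits (suc k) = inc (bits k)

  ones : List Bool → ℕ
  ones []      = 0
  ones (b ∷ β) = ind b + ones β

  -- This is E(m): the binary expansions of the numbers below `m` are the characteristic vectors of
  -- the first `m` sets in colex order.
  popSum : ℕ → ℕ
  popSum zero    = 0
  popSum (suc m) = popSum m + ones (bits m)

  double : ℕ → ℕ
  double zero    = zero
  double (suc k) = suc (suc (double k))

  double≡ : ∀ k → double k ≡ k + k
  double≡ zero    = refl
  double≡ (suc k) = cong suc (trans (cong suc (double≡ k)) (sym (+-suc k k)))

  double-+ : ∀ a b → double a + double b ≡ double (a + b)
  double-+ zero    b = refl
  double-+ (suc a) b = cong (λ k → suc (suc k)) (double-+ a b)

  bits-odd : ∀ k → bits (suc (double k)) ≡ true ∷ bits k
  bits-odd zero    = refl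
  bits-odd (suc k) = cong (inc ∘ inc) (bits-odd k)

  ones-even : ∀ k → ones (bits (double k)) ≡ ones (bits k)
  ones-even zero    = refl
  ones-even (suc k) = cong (ones ∘ inc) (bits-odd k)

  -- The number 2i has as many ones as i, and 2i + 1 has one more. Separating even and odd numbers
  -- gives this recurrence and `popSum-odd`.
  popSum-even : ∀ k → popSum (double k) ≡ popSum k + popSum k + k
  popSum-even zero = refl
  popSum-even (suc k) rewrite popSum-even k | ones-even k | bits-odd k =
    rearrange (popSum k) k (ones (bits k))
    where
    rearrange : ∀ e k o → e + e + k + o + (1 + o) ≡ e + o + (e + o) + suc k
    rearrange = solve-∀

  popSum-odd : ∀ k → popSum (suc (double k)) ≡ popSum (suc k) + popSum k + k
  popSum-odd k rewrite popSum-even k | ones-even k = rearrange (popSum k) k (ones (bits k))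
    where
    rearrange : ∀ e k o → e + e + k + o ≡ e + o + e + k
    rearrange = solve-∀

  data Parity : ℕ → Set where
    even : ∀ k → Parity (double k)
    odd  : ∀ k → Parity (suc (double k))

  parity : ∀ m → Parity m
  parity zero = even 0
  parity (suc m) with parity m
  ... | even k = odd k
  ... | odd k  = even (suc k)

  -- Superadditivity of the binary digit sums

  Superadditive : ℕ → ℕ → Set
  Superadditive a b = popSum a + popSum b + (a ⊓ b) ≤ popSum (a + b)

  superadditive-sym : ∀ a b → Superadditive a b → Superadditive b a
  superadditive-sym a b h = subst₂ _≤_
    (cong₂ _+_ (+-comm (popSum a) (popSum b)) (⊓-comm a b)) (cong popSum (+-comm a b)) h

  -- The common skeleton of the parity cases: two instances at the halves are added, and `a`, `b`
  -- and `c + (a + b)` are the linear terms of the recurrences. The surplus `c` is 1 when both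
  -- arguments are odd and 0 otherwise.
  regroup : ∀ e₁ e₂ f₁ f₂ μ₁ μ₂ c a b {s₁ s₂ m} → e₁ + f₁ + μ₁ ≤ s₁ → e₂ + f₂ + μ₂ ≤ s₂ →
    m ≤ μ₁ + μ₂ + c → (e₁ + e₂ + a) + (f₁ + f₂ + b) + m ≤ s₁ + s₂ + (c + (a + b))
  regroup e₁ e₂ f₁ f₂ μ₁ μ₂ c a b {s₁} {s₂} {m} p q r = begin
    (e₁ + e₂ + a) + (f₁ + f₂ + b) + m
      ≤⟨ +-monoʳ-≤ ((e₁ + e₂ + a) + (f₁ + f₂ + b)) r ⟩
    (e₁ + e₂ + a) + (f₁ + f₂ + b) + (μ₁ + μ₂ + c)
      ≡⟨ shuffle e₁ e₂ f₁ f₂ μ₁ μ₂ a b c ⟩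
    (e₁ + f₁ + μ₁) + (e₂ + f₂ + μ₂) + (c + (a + b))
      ≤⟨ +-monoˡ-≤ (c + (a + b)) (+-mono-≤ p q) ⟩
    s₁ + s₂ + (c + (a + b)) ∎
    where
    open ≤-Reasoning
    shuffle : ∀ e₁ e₂ f₁ f₂ μ₁ μ₂ a b c → (e₁ + e₂ + a) + (f₁ + f₂ + b) + (μ₁ + μ₂ + c)
      ≡ (e₁ + f₁ + μ₁) + (e₂ + f₂ + μ₂) + (c + (a + b))
    shuffle = solve-∀

  k≤double : ∀ k → k ≤ double k
  k≤double k = ≤-trans (m≤m+n k k) (≤-reflexive (sym (double≡ k)))

  half-≤ : ∀ {s N} → double (suc s) ≤ suc N → suc s ≤ N
  half-≤ {s} (s≤s h) = ≤-trans (s≤s (k≤double s)) h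

  double-⊓-≤ : ∀ a b → double a ⊓ double b ≤ (a ⊓ b) + (a ⊓ b) + 0
  double-⊓-≤ a b with ≤-total a b
  ... | inj₁ a≤b rewrite m≤n⇒m⊓n≡m a≤b | sym (double≡ a) | +-identityʳ (double a) = m⊓n≤m _ _
  ... | inj₂ b≤a rewrite m≥n⇒m⊓n≡n b≤a | sym (double≡ b) | +-identityʳ (double b) = m⊓n≤n _ _

  odd-even-⊓-≤ : ∀ a b → suc (double a) ⊓ double b ≤ (suc a ⊓ b) + (a ⊓ b) + 0
  odd-even-⊓-≤ a b rewrite +-identityʳ ((suc a ⊓ b) + (a ⊓ b)) with <-≤-connex a b
  ... | inj₁ a<b rewrite m≤n⇒m⊓n≡m a<b | m≤n⇒m⊓n≡m (<⇒≤ a<b) | sym (double≡ a) = m⊓n≤m _ _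
  ... | inj₂ b≤a rewrite m≥n⇒m⊓n≡n (m≤n⇒m≤1+n b≤a) | m≥n⇒m⊓n≡n b≤a | sym (double≡ b) = m⊓n≤n _ _

  odd-odd-⊓-≤ : ∀ a b → suc (double a) ⊓ suc (double b) ≤ (suc a ⊓ b) + (a ⊓ suc b) + 1
  odd-odd-⊓-≤ a b rewrite +-comm ((suc a ⊓ b) + (a ⊓ suc b)) 1 with ≤-total a b
  ... | inj₁ a≤b = ≤-trans (m⊓n≤m _ _) (s≤s (≤-trans (≤-reflexive (double≡ a))
          (+-mono-≤ (⊓-glb (n≤1+n a) a≤b) (⊓-glb ≤-refl (m≤n⇒m≤1+n a≤b)))))
  ... | inj₂ b≤a = ≤-trans (m⊓n≤n _ _) (s≤s (≤-trans (≤-reflexive (double≡ b))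
          (+-mono-≤ (⊓-glb (m≤n⇒m≤1+n b≤a) ≤-refl) (⊓-glb b≤a (n≤1+n b)))))

  -- Strong induction on the sum of the arguments. The recurrences for even and odd arguments reduce
  -- each case to two instances of about half the size.
  popSum-superadditive : ∀ a b → Superadditive a b
  popSum-superadditive a b = go (a + b) a b ≤-refl
    where
    even-even : ∀ a b → Superadditive a b → Superadditive (double a) (double b)
    even-even a b h rewrite double-+ a b | popSum-even a | popSum-even b | popSum-even (a + b) =
      regroup (popSum a) (popSum a) (popSum b) (popSum b) (a ⊓ b) (a ⊓ b) 0 a b h h (double-⊓-≤ a b)

    odd-even : ∀ a b → Superadditive (suc a) b → Superadditive a b →
      Superadditive (suc (double a)) (double b)
    odd-even a b h₁ h₂
      rewrite double-+ a b | popSum-odd a | popSum-even b | popSum-odd (a + b) =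
      regroup (popSum (suc a)) (popSum a) (popSum b) (popSum b) (suc a ⊓ b) (a ⊓ b) 0 a b h₁ h₂ (odd-even-⊓-≤ a b)

    -- The halves are paired crosswise, so that both instances have the sum a + b + 1 that the even
    -- total requires.
    odd-odd : ∀ a b → Superadditive (suc a) b → Superadditive a (suc b) →
      Superadditive (suc (double a)) (suc (double b))
    odd-odd a b h₁ h₂
      rewrite +-suc (double a) (double b) | double-+ a b | popSum-odd a | popSum-odd b
      | +-comm (popSum (suc b)) (popSum b) | popSum-even (suc (a + b)) | +-suc a b =
      regroup (popSum (suc a)) (popSum a) (popSum b) (popSum (suc b)) (suc a ⊓ b) (a ⊓ suc b) 1 a b h₁ h₂ (odd-odd-⊓-≤ a b)

    zeroˡ : ∀ b → Superadditive 0 b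
    zeroˡ b = ≤-reflexive (+-identityʳ (popSum b))

    odd-even-< : ∀ {N} a b → suc (double a) + double (suc b) ≤ suc N → suc (a + suc b) ≤ N
    odd-even-< {N} a b (s≤s h) rewrite double-+ a (suc b) | +-suc a b =
      ≤-trans (s≤s (s≤s (k≤double (a + b)))) h

    go : ∀ N a b → a + b ≤ N → Superadditive a b
    go zero zero zero _ = z≤n
    go (suc N) a b h with parity a | parity b
    -- Zero arguments are treated apart, because halving need not decrease the sum there: (1, 0)
    -- would lead back to itself.
    ... | even zero    | _            = zeroˡ b
    ... | even (suc a) | even zero    = superadditive-sym 0 (double (suc a)) (zeroˡ (double (suc a)))
    ... | odd a        | even zero    = superadditive-sym 0 (suc (double a)) (zeroˡ (suc (double a)))
    ... | even (suc a) | even (suc b) = even-even (suc a) (suc b)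
          (go N (suc a) (suc b) (half-≤ (subst (_≤ suc N) (double-+ (suc a) (suc b)) h)))
    ... | odd a        | even (suc b) = odd-even a (suc b)
          (go N (suc a) (suc b) (odd-even-< a b h)) (go N a (suc b) (≤-trans (n≤1+n _) (odd-even-< a b h)))
    ... | even (suc a) | odd b        = superadditive-sym (suc (double b)) (double (suc a))
          (odd-even b (suc a) (go N (suc b) (suc a) h′) (go N b (suc a) (≤-trans (n≤1+n _) h′)))
      where h′ = odd-even-< b a (subst (_≤ suc N) (+-comm (double (suc a)) (suc (double b))) h)
    ... | odd a        | odd b        = odd-odd a b
          (go N (suc a) b h′) (go N a (suc b) (subst (_≤ N) (sym (+-suc a b)) h′))
      where
      h′ = half-≤ (subst (_≤ suc N)
        (trans (+-suc (suc (double a)) (double b)) (cong (λ k → suc (suc k)) (double-+ a b))) h)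

  -- Edges of the cube inside a family

  edges : Fam n → ℕ
  edges {zero}  F = 0
  edges {suc n} F = edges (F ↾ false) + edges (F ↾ true) + count ((F ↾ false) ∩ (F ↾ true))

  -- The edges in the head direction are at most as many as the sets in the smaller half, and
  -- superadditivity of `popSum` closes the induction.
  edge-isoperimetry : (F : Fam n) → edges F ≤ popSum (count F)
  edge-isoperimetry {zero}  F = z≤n
  edge-isoperimetry {suc n} F = ≤-trans
    (+-mono-≤ (+-mono-≤ (edge-isoperimetry F₀) (edge-isoperimetry F₁))
      (⊓-glb (count-mono (λ A → proj₁ ∘ ∧-true {F₀ A})) (count-mono (λ A → proj₂ ∘ ∧-true {F₀ A}))))
    (popSum-superadditive (count F₀) (count F₁))
    where
    F₀ = F ↾ false
    F₁ = F ↾ true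

  downDegree : Fam n → Subset n → ℕ
  downDegree F []          = 0
  downDegree F (false ∷ A) = downDegree (F ↾ false) A
  downDegree F (true  ∷ A) = downDegree (F ↾ true) A + ind (F (false ∷ A))

  -- Each edge is counted once, at its upper end.
  ∑-downDegree : (F : Fam n) → ∑ (λ A → ind (F A) * downDegree F A) ≡ edges F
  ∑-downDegree {zero}  F = *-zeroʳ (ind (F []))
  ∑-downDegree {suc n} F = trans
    (cong₂ _+_ (∑-downDegree F₀)
      (trans (∑-cong split)
        (trans (∑-+ (λ A → ind (F₁ A) * downDegree F₁ A) _) (cong (_+ count (F₀ ∩ F₁)) (∑-downDegree F₁)))))
    (sym (+-assoc (edges F₀) (edges F₁) _))
    where
    F₀ = F ↾ false
    F₁ = F ↾ true
    ind-∧ : ∀ a b → ind b * ind a ≡ ind (a ∧ b)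
    ind-∧ false b     = *-zeroʳ (ind b)
    ind-∧ true  false = refl
    ind-∧ true  true  = refl
    split : ∀ A → ind (F₁ A) * (downDegree F₁ A + ind (F₀ A))
                ≡ ind (F₁ A) * downDegree F₁ A + ind ((F₀ ∩ F₁) A)
    split A = trans (*-distribˡ-+ (ind (F₁ A)) _ _) (cong (ind (F₁ A) * downDegree F₁ A +_) (ind-∧ (F₀ A) (F₁ A)))

  ∣∣≤downDegree : (F : Fam n) (A : Subset n) → (∀ k → k ∈ A → F ∋ (A [ k ]≔ false)) →
    ∣ A ∣ ≤ downDegree F A
  ∣∣≤downDegree F []          h = z≤n
  ∣∣≤downDegree F (false ∷ A) h = ∣∣≤downDegree (F ↾ false) A (λ k → h (suc k) ∘ there)
  ∣∣≤downDegree F (true  ∷ A) h rewrite h zero here | +-comm (downDegree (F ↾ true) A) 1 =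
    s≤s (∣∣≤downDegree (F ↾ true) A (λ k → h (suc k) ∘ there))

  ∣∣≤1+downDegree : (F : Fam n) (A : Subset n) {j : Fin n} →
    (∀ k → k ≢ j → k ∈ A → F ∋ (A [ k ]≔ false)) → ∣ A ∣ ≤ suc (downDegree F A)
  ∣∣≤1+downDegree F (false ∷ A) {zero} h =
    m≤n⇒m≤1+n (∣∣≤downDegree (F ↾ false) A (λ k → h (suc k) (λ ()) ∘ there))
  ∣∣≤1+downDegree F (true ∷ A) {zero} h =
    s≤s (≤-trans (∣∣≤downDegree (F ↾ true) A (λ k → h (suc k) (λ ()) ∘ there)) (m≤m+n _ _))
  ∣∣≤1+downDegree F (false ∷ A) {suc j} h =
    ∣∣≤1+downDegree (F ↾ false) A {j} (λ k k≢j → h (suc k) (λ { refl → k≢j refl }) ∘ there)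
  ∣∣≤1+downDegree F (true ∷ A) {suc j} h
    rewrite h zero (λ ()) here | +-comm (downDegree (F ↾ true) A) 1 =
    s≤s (∣∣≤1+downDegree (F ↾ true) A {j} (λ k k≢j → h (suc k) (λ { refl → k≢j refl }) ∘ there))

  -- For each `A` in `F`, its size plus 1 if it is full is at most its down-degree plus 1: a full
  -- set has all lower neighbours in `F`, any other set all but possibly one. Summing turns
  -- down-degrees into edges.
  norm-rooted : (F : Fam n) → Rooted F → norm F + count (full F) ≤ popSum (count F) + count F
  norm-rooted F rF = ≤-trans
    (∑-+-mono (λ A → ind (F A) * ∣ A ∣) (ind ∘ full F) (λ A → ind (F A) * downDegree F A) (ind ∘ F) pointwise)
    (+-monoˡ-≤ (count F) (≤-trans (≤-reflexive (∑-downDegree F)) (edge-isoperimetry F)))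
    where
    down-∈ : ∀ {k ℓ A} → ℓ ≢ just k → RootedBy F ℓ A → F ∋ (A [ k ]≔ false)
    down-∈ {A = A} ℓ≢k (ℓ∈A , h) = h _ (∈ₗ-≔⁺ ℓ≢k ℓ∈A) (≔-⊆ {A = A})

    pointwise : ∀ A → ind (F A) * ∣ A ∣ + ind (full F A) ≤ ind (F A) * downDegree F A + ind (F A)
    pointwise A with full F A in eq
    ... | true rewrite full⊑ F A eq =
          +-monoˡ-≤ 1 (+-monoˡ-≤ 0 (∣∣≤downDegree F A (λ k _ → full⁻ {F = F} eq (≔-⊆ {A = A}))))
    ... | false with F A in eq′
    ... | false = z≤n
    ... | true with rF A eq′
    ... | nothing , r = case trans (sym eq) (full⁺ F r) of λ ()
    ... | just j , r = ≤-trans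
          (+-monoˡ-≤ 0 (+-monoˡ-≤ 0 (∣∣≤1+downDegree F A {j}
            (λ k k≢j _ → down-∈ {A = A} (k≢j ∘ sym ∘ just-injective) r))))
          (≤-reflexive (shift (downDegree F A)))
      where
      shift : ∀ d → suc d + 0 + 0 ≡ d + 0 + 1
      shift = solve-∀

  -- Sets rooted at a point of a prescribed set J

  module _ (F : Fam n) where

    rootedIn? : (J : Fin n → Bool) (A : Subset n) →
      Dec (RootedBy F nothing A ⊎ ∃ λ i → J i ≡ true × RootedBy F (just i) A)
    rootedIn? J A = rootedBy? F nothing A ⊎-dec any? (λ i → (J i ≟ᵇ true) ×-dec rootedBy? F (just i) A)

    rootedIn : (Fin n → Bool) → Fam n
    rootedIn J A = does (rootedIn? J A)

    rootedIn⁺ : ∀ {J ℓ A} → Maybe.All (λ i → J i ≡ true) ℓ → RootedBy F ℓ A → rootedIn J ∋ A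
    rootedIn⁺ {J} {A = A} nothing   r = dec-true (rootedIn? J A) (inj₁ r)
    rootedIn⁺ {J} {A = A} (just Ji) r = dec-true (rootedIn? J A) (inj₂ (_ , Ji , r))

    rootedIn⁻ : ∀ {J A} → rootedIn J ∋ A → ∃ λ ℓ → Maybe.All (λ i → J i ≡ true) ℓ × RootedBy F ℓ A
    rootedIn⁻ {J} {A} p with does-true (rootedIn? J A) p
    ... | inj₁ r            = nothing , nothing , r
    ... | inj₂ (i , Ji , r) = just i , just Ji , r

    rootedIn-⊑ : ∀ {J} → rootedIn J ⊑ F
    rootedIn-⊑ A p with rootedIn⁻ p
    ... | _ , _ , r = rooted-∋ r

    -- The root is `nothing` or a point of `J`, so it is not `k` and survives the removal of `k`.
    rootedIn-closed : ∀ {J k} → J k ≡ false → Closed k (rootedIn J)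
    rootedIn-closed {J} {k} ¬Jk A p with rootedIn⁻ p
    ... | ℓ , Jℓ , (ℓ∈A , h) = rootedIn⁺ Jℓ
          (∈ₗ-≔⁺ (avoids Jℓ) ℓ∈A , λ C ℓ∈C C⊆A → h C ℓ∈C (⊆-trans C⊆A (≔-⊆ {A = A})))
      where
      avoids : ∀ {ℓ} → Maybe.All (λ i → J i ≡ true) ℓ → ℓ ≢ just k
      avoids (just Jk) refl = case trans (sym ¬Jk) Jk of λ ()

    -- All sets between the root and `A` have the same root, hence belong to the same subfamily.
    rootedIn-rooted : ∀ {J A} → rootedIn J ∋ A → ∃ λ ℓ → RootedBy (rootedIn J) ℓ A
    rootedIn-rooted p with rootedIn⁻ p
    ... | ℓ , Jℓ , (ℓ∈A , h) = ℓ , ℓ∈A ,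
          λ C ℓ∈C C⊆A → rootedIn⁺ Jℓ (ℓ∈C , λ D ℓ∈D D⊆C → h D ℓ∈D (⊆-trans D⊆C C⊆A))

  -- The norm bound for a splitting of [n]

  -- A subset of `A` containing `j` lies in `Y` by rootedness; one avoiding `j` lies below `A`
  -- without `j`, which is full.
  full-fills : {G Y : Fam n} {ℓ : Label n} {A : Subset n} → Y ⊑ G → RootedBy Y ℓ A → Fills (full G) ℓ A
  full-fills {ℓ = nothing} Y⊑G r = nothing
  full-fills {G = G} {Y} {just j} {A} Y⊑G (_ , h) = just λ p → full⁺ G (nothing , mem p)
    where
    mem : full G ∋ (A [ j ]≔ false) → ∀ C → nothing ∈ₗ C → C ⊆ A → G ∋ C
    mem p C _ C⊆A with lookup C j in eq
    ... | true  = Y⊑G C (h C (just (lookup⇒[]= j C eq)) C⊆A)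
    ... | false = full⁻ {F = G} p (subst (_⊆ A [ j ]≔ false) (≔-id eq) (≔-mono C⊆A))

  count-split : (P Q : Fam n) → count P ≡ count (P ∖ Q) + count (P ∩ Q)
  count-split P Q = trans (∑-cong (λ A → cell (P A) (Q A))) (∑-+ (ind ∘ (P ∖ Q)) (ind ∘ (P ∩ Q)))
    where
    cell : ∀ p q → ind p ≡ ind (p ∧ not q) + ind (p ∧ q)
    cell false q     = refl
    cell true  false = refl
    cell true  true  = refl

  count-cover : {P Q R : Fam n} → (∀ A → P ∋ A → Q ∋ A ⊎ R ∋ A) → count P ≤ count Q + count R
  count-cover {P = P} {Q} {R} h = subst (count P ≤_) (∑-+ (ind ∘ Q) (ind ∘ R)) (∑-mono cell)
    where
    cell : ∀ A → ind (P A) ≤ ind (Q A) + ind (R A)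
    cell A with P A in eq
    ... | false = z≤n
    ... | true with h A eq
    ... | inj₁ q rewrite q = s≤s z≤n
    ... | inj₂ r rewrite r = m≤n+m 1 (ind (Q A))

  module _ {L : List (Fin n)} {F X Y : Fam n} (R : Compressed L F X Y)
    (X-closed : ∀ j → j LMem.∈ L ⊎ Closed j X)
    (Y-rooted : ∀ A → Y ∋ A → ∃ λ ℓ → RootedBy Y ℓ A) where

    private
      module R = Compressed R

      Q : Fam n
      Q = full R.G

      -- By now `X′` is closed along every coordinate, hence a down-set inside `G`, and all its
      -- members are full in `G`.
      X′⊑Q : R.X′ ⊑ Q
      X′⊑Q A p = full⁺ R.G (nothing , λ C _ C⊆A →
        R.X′⊑G C (closed-⊆ {F = R.X′} (λ j → R.closed j (X-closed j)) p C⊆A))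

      fills : ∀ A → Y ∋ A → ∃ λ ℓ → RootedBy Y ℓ A × Fills Q ℓ A
      fills A p with Y-rooted A p
      ... | ℓ , r = ℓ , r , full-fills R.Y⊑G r

      -- `norm-G` leaves only the full sets of `G` outside `Y` on the right; together with those in
      -- `Y` they make up `Q`, which `norm-rooted` pays for.
      unmoved : norm F + count (Q ∩ Y) ≤ popSum (count F) + count F
      unmoved = begin
        norm F + count (Q ∩ Y)
          ≤⟨ +-monoˡ-≤ (count (Q ∩ Y)) (≤-trans (m≤m+n (norm F) (count (full F ∖ Y))) R.norm-G) ⟩
        norm R.G + count (Q ∖ Y) + count (Q ∩ Y)
          ≡⟨ +-assoc (norm R.G) (count (Q ∖ Y)) (count (Q ∩ Y)) ⟩
        norm R.G + (count (Q ∖ Y) + count (Q ∩ Y))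
          ≡⟨ cong (norm R.G +_) (count-split Q Y) ⟨
        norm R.G + count Q
          ≤⟨ norm-rooted R.G R.rooted ⟩
        popSum (count R.G) + count R.G
          ≡⟨ cong (λ m → popSum m + m) R.count-G ⟩
        popSum (count F) + count F ∎
        where open ≤-Reasoning

    compressed-bound :
      2 ^ n * norm F + count X * count Y ≤ 2 ^ n * (popSum (count F) + count F)
    compressed-bound = begin
      2 ^ n * norm F + count X * count Y
        ≡⟨ cong (λ x → 2 ^ n * norm F + x * count Y) R.count-X′ ⟨
      2 ^ n * norm F + count R.X′ * count Y
        ≤⟨ +-monoʳ-≤ (2 ^ n * norm F) (*-monoˡ-≤ (count Y) (count-mono X′⊑Q)) ⟩
      2 ^ n * norm F + count Q * count Y
        ≤⟨ +-monoʳ-≤ (2 ^ n * norm F) (correlation Q Y (full-closed R.G) fills) ⟩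
      2 ^ n * norm F + 2 ^ n * count (Q ∩ Y)
        ≡⟨ *-distribˡ-+ (2 ^ n) (norm F) (count (Q ∩ Y)) ⟨
      2 ^ n * (norm F + count (Q ∩ Y))
        ≤⟨ *-monoʳ-≤ (2 ^ n) unmoved ⟩
      2 ^ n * (popSum (count F) + count F) ∎
      where open ≤-Reasoning

  -- Compression runs along the points of `J`. There the sets rooted outside `J` form a closed
  -- family, and along all other points the sets rooted in `J` are closed from the start.
  norm-bound : (F : Fam n) → Rooted F → (J : Fin n → Bool) →
    2 ^ n * norm F + count (rootedIn F J) * count (rootedIn F (not ∘ J))
      ≤ 2 ^ n * (popSum (count F) + count F)
  norm-bound {n} F rF J = compressed-bound
    (compressAll L rF (rootedIn-⊑ F) (rootedIn-⊑ F) Y-closed) X-closed (λ A → rootedIn-rooted F)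
    where
    J? : ∀ i → Dec (J i ≡ true)
    J? i = J i ≟ᵇ true

    L : List (Fin n)
    L = filter J? (allFin n)

    Y-closed : ∀ k → k LMem.∈ L → Closed k (rootedIn F (not ∘ J))
    Y-closed k k∈L = rootedIn-closed F (cong not (proj₂ (∈-filter⁻ J? {xs = allFin n} k∈L)))

    X-closed : ∀ j → j LMem.∈ L ⊎ Closed j (rootedIn F J)
    X-closed j with J j in eq
    ... | true  = inj₁ (∈-filter⁺ J? (∈-allFin j) eq)
    ... | false = inj₂ (rootedIn-closed F eq)

  -- Choosing a balanced prefix

  -- The search goes down from `N` and stops where the predecessor fails `P`.
  first : {P : ℕ → Set} → (∀ s → Dec (P s)) → ∀ N → P N →
    ∃ λ s → P s × (s ≡ 0 ⊎ ∃ λ t → s ≡ suc t × ¬ P t)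
  first P? zero    p = 0 , p , inj₁ refl
  first P? (suc N) p with P? N
  ... | yes q = first P? N q
  ... | no ¬q = suc N , p , inj₂ (N , refl , ¬q)

  rootedAt : Fam n → Fin n → Fam n
  rootedAt F i A = does (rootedBy? F (just i) A)

  -- The density p is written as a / (a + c), so that 1 - p is c / (a + c).
  module _ (F : Fam n) (rF : Rooted F) (a c : ℕ)
    (bound : ∀ i → (a + c) * count (rootedAt F i) ≤ a * count F) where

    private
      b = a + c
      m = count F

      below : ℕ → Fin n → Bool
      below s i = does (toℕ i <? s)

      x y : ℕ → ℕ
      x s = count (rootedIn F (below s))
      y s = count (rootedIn F (not ∘ below s))

      all-J : {J : Fin n → Bool} → (∀ i → J i ≡ true) → ∀ ℓ → Maybe.All (λ i → J i ≡ true) ℓ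
      all-J h nothing  = nothing
      all-J h (just i) = just (h i)

      all-rooted : {J : Fin n → Bool} → (∀ i → J i ≡ true) → m ≤ count (rootedIn F J)
      all-rooted h = count-mono λ A p → case rF A p of λ (ℓ , r) → rootedIn⁺ F (all-J h ℓ) r

      -- Lengthening the prefix by one point adds only sets rooted at that point, at most p m of
      -- them; beyond `n` nothing is added.
      x-step : ∀ s → b * x (suc s) ≤ b * x s + a * m
      x-step s with s <? n
      ... | no s≮n = ≤-trans (*-monoʳ-≤ b (count-mono shrink)) (m≤m+n _ _)
        where
        shrinkₗ : ∀ {ℓ} → Maybe.All (λ i → below (suc s) i ≡ true) ℓ → Maybe.All (λ i → below s i ≡ true) ℓ
        shrinkₗ nothing = nothing
        shrinkₗ (just {x = i} _) = just (dec-true (toℕ i <? s) (<-≤-trans (toℕ<n i) (≮⇒≥ s≮n)))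
        shrink : rootedIn F (below (suc s)) ⊑ rootedIn F (below s)
        shrink A p with rootedIn⁻ F p
        ... | ℓ , J , r = rootedIn⁺ F (shrinkₗ J) r
      ... | yes s<n = begin
          b * x (suc s)
            ≤⟨ *-monoʳ-≤ b (count-cover {R = rootedAt F i} split) ⟩
          b * (x s + count (rootedAt F i))
            ≡⟨ *-distribˡ-+ b (x s) _ ⟩
          b * x s + b * count (rootedAt F i)
            ≤⟨ +-monoʳ-≤ (b * x s) (bound i) ⟩
          b * x s + a * m ∎
        where
        open ≤-Reasoning
        i = fromℕ< s<n
        split : ∀ A → rootedIn F (below (suc s)) ∋ A → rootedIn F (below s) ∋ A ⊎ rootedAt F i ∋ A
        split A p with rootedIn⁻ F p
        ... | nothing , _ , r = inj₁ (rootedIn⁺ F nothing r)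
        ... | just j , just Jj , r with toℕ j <? s
        ... | yes j<s = inj₁ (rootedIn⁺ F (just (dec-true (toℕ j <? s) j<s)) r)
        ... | no j≮s = inj₂ (dec-true (rootedBy? F (just i) A) (subst (λ k → RootedBy F (just k) A) j≡i r))
          where
          j≡s : toℕ j ≡ s
          j≡s = ≤-antisym (≤-pred (does-true (toℕ j <? suc s) Jj)) (≮⇒≥ j≮s)
          j≡i : j ≡ i
          j≡i = trans (sym (fromℕ<-toℕ j (toℕ<n j))) (fromℕ<-cong _ _ j≡s _ _)

      cover : ∀ s → m ≤ x s + y s
      cover s = count-cover {Q = rootedIn F (below s)} {rootedIn F (not ∘ below s)} split
        where
        split : ∀ A → F ∋ A → rootedIn F (below s) ∋ A ⊎ rootedIn F (not ∘ below s) ∋ A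
        split A p with rF A p
        ... | nothing , r = inj₁ (rootedIn⁺ F nothing r)
        ... | just i , r with below s i in eq
        ... | true  = inj₁ (rootedIn⁺ F (just eq) r)
        ... | false = inj₂ (rootedIn⁺ F (just (cong not eq)) r)

    -- One of `u` and `v` is at least `w`, since their average is, and the other is at least `z`.
    balanced-product : ∀ {u v w z} → z ≤ u → z ≤ v → w + w ≤ u + v → w * z ≤ u * v
    balanced-product {u} {v} {w} {z} z≤u z≤v h with ≤-total w u
    ... | inj₁ w≤u = *-mono-≤ w≤u z≤v
    ... | inj₂ u≤w = subst (w * z ≤_) (*-comm v u) (*-mono-≤ (+-cancelˡ-≤ w _ _ (≤-trans h (+-monoˡ-≤ v u≤w))) z≤u)

    -- Both sides of the first prefix reaching weight (c / 2b) m are at least that heavy.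
    balanced-prefix : ∃ λ s → c * m ≤ 2 * b * x s × c * m ≤ 2 * b * y s
    balanced-prefix with first (λ s → c * m ≤? 2 * b * x s) n reached
      where
      reached : c * m ≤ 2 * b * x n
      reached = *-mono-≤ (≤-trans (m≤n+m c a) (m≤m+n b _)) (all-rooted λ i → dec-true (toℕ i <? n) (toℕ<n i))
    ... | s , p , inj₁ refl = 0 , p ,
          *-mono-≤ (≤-trans (m≤n+m c a) (m≤m+n b _)) (all-rooted λ i → cong not (dec-false (toℕ i <? 0) λ ()))
    -- As `t` misses the threshold, 2b x(t + 1) is at most c m + 2 a m. Out of the total 2b m = 2 a
    -- m + 2 c m this leaves c m for the other side.
    ... | s , p , inj₂ (t , refl , ¬q) = suc t , p , +-cancelˡ-≤ (c * m + 2 * (a * m)) _ _ (begin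
        c * m + 2 * (a * m) + c * m
          ≡⟨ collect a c m ⟩
        2 * b * m
          ≤⟨ *-monoʳ-≤ (2 * b) (cover (suc t)) ⟩
        2 * b * (x (suc t) + y (suc t))
          ≡⟨ *-distribˡ-+ (2 * b) (x (suc t)) _ ⟩
        2 * b * x (suc t) + 2 * b * y (suc t)
          ≤⟨ +-monoˡ-≤ (2 * b * y (suc t)) small ⟩
        c * m + 2 * (a * m) + 2 * b * y (suc t) ∎)
      where
      open ≤-Reasoning
      collect : ∀ a c m → c * m + 2 * (a * m) + c * m ≡ 2 * (a + c) * m
      collect = solve-∀
      small : 2 * b * x (suc t) ≤ c * m + 2 * (a * m)
      small = begin
        2 * b * x (suc t)             ≡⟨ *-assoc 2 b _ ⟩
        2 * (b * x (suc t))           ≤⟨ *-monoʳ-≤ 2 (x-step t) ⟩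
        2 * (b * x t + a * m)         ≡⟨ *-distribˡ-+ 2 (b * x t) _ ⟩
        2 * (b * x t) + 2 * (a * m)   ≡⟨ cong (_+ 2 * (a * m)) (*-assoc 2 b _) ⟨
        2 * b * x t + 2 * (a * m)     ≤⟨ +-monoˡ-≤ (2 * (a * m)) (<⇒≤ (≰⇒> ¬q)) ⟩
        c * m + 2 * (a * m)           ∎

    stability : .{{NonZero b}} → ∃ λ z →
      2 ^ n * norm F + z ≤ 2 ^ n * (popSum m + m) × c * (m * m) ≤ 4 * b * z
    stability with balanced-prefix
    -- With b m as the lower bound for the average and c m as that for each factor,
    -- `balanced-product` gives (b m)(c m) ≤ (2b x)(2b y); one factor b is then cancelled.
    ... | s , p , q = x s * y s , norm-bound F rF (below s) , *-cancelˡ-≤ b (begin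
        b * (c * (m * m))             ≡⟨ e₁ b c m ⟩
        b * m * (c * m)               ≤⟨ balanced-product {w = b * m} p q total ⟩
        2 * b * x s * (2 * b * y s)   ≡⟨ e₂ b (x s) (y s) ⟩
        b * (4 * b * (x s * y s))     ∎)
      where
      open ≤-Reasoning
      e₁ : ∀ b c m → b * (c * (m * m)) ≡ b * m * (c * m)
      e₁ = solve-∀
      e₂ : ∀ b x y → 2 * b * x * (2 * b * y) ≡ b * (4 * b * (x * y))
      e₂ = solve-∀
      e₃ : ∀ b m → b * m + b * m ≡ 2 * b * m
      e₃ = solve-∀
      total : b * m + b * m ≤ 2 * b * x s + 2 * b * y s
      total = begin
        b * m + b * m                 ≡⟨ e₃ b m ⟩
        2 * b * m                     ≤⟨ *-monoʳ-≤ (2 * b) (cover s) ⟩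
        2 * b * (x s + y s)           ≡⟨ *-distribˡ-+ (2 * b) (x s) _ ⟩
        2 * b * x s + 2 * b * y s     ∎

  -- Colex order through binary expansions

  -- The j-th bit decides about the element d + j.
  toSet : ℕ → List Bool → List ℕ
  toSet d []          = []
  toSet d (false ∷ β) = toSet (suc d) β
  toSet d (true  ∷ β) = d ∷ toSet (suc d) β

  length-toSet : ∀ d β → length (toSet d β) ≡ ones β
  length-toSet d []          = refl
  length-toSet d (false ∷ β) = length-toSet (suc d) β
  length-toSet d (true  ∷ β) = cong suc (length-toSet (suc d) β)

  toSet-≥ : ∀ d β → All (d ≤_) (toSet d β)
  toSet-≥ d []          = []
  toSet-≥ d (false ∷ β) = All.map <⇒≤ (toSet-≥ (suc d) β)
  toSet-≥ d (true  ∷ β) = ≤-refl ∷ All.map <⇒≤ (toSet-≥ (suc d) β)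

  toSet-increasing : ∀ d β → AllPairs _<_ (toSet d β)
  toSet-increasing d []          = []
  toSet-increasing d (false ∷ β) = toSet-increasing (suc d) β
  toSet-increasing d (true  ∷ β) = toSet-≥ (suc d) β ∷ toSet-increasing (suc d) β

  toSet-surjective : ∀ d {A} → AllPairs _<_ A → All (d ≤_) A → ∃ λ β → toSet d β ≡ A
  toSet-surjective d [] [] = [] , refl
  toSet-surjective d {x ∷ A} (x<A ∷ incr) (d≤x ∷ _) with toSet-surjective (suc x) incr x<A
  ... | β , refl = pad (≤⇒≤‴ d≤x)
    where
    pad : ∀ {d} → d ≤‴ x → ∃ λ γ → toSet d γ ≡ x ∷ A
    pad ≤‴-refl = true ∷ β , refl
    pad (≤‴-step d<x) with pad d<x
    ... | γ , eq = false ∷ γ , eq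

  -- Only the sets are compared, because `β` may end in zeros while `bits k` does not. For the same
  -- reason a zero digit in front of k = 0 yields 0 again.
  bits-surjective : ∀ d β → ∃ λ k → toSet d (bits k) ≡ toSet d β
  bits-surjective d [] = 0 , refl
  bits-surjective d (b ∷ β) with bits-surjective (suc d) β
  bits-surjective d (true ∷ β) | k , eq =
    suc (double k) , trans (cong (toSet d) (bits-odd k)) (cong (d ∷_) eq)
  bits-surjective d (false ∷ β) | zero  , eq = 0 , eq
  bits-surjective d (false ∷ β) | suc k , eq =
    double (suc k) , trans (cong (toSet d ∘ inc) (bits-odd k)) eq

  -- The increment turns the lowest zero digit into a one. This digit is the maximum of the
  -- symmetric difference: lower digits are cleared and higher ones are untouched.
  inc-<colex : ∀ d β → toSet d β <colex toSet d (inc β)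
  inc-<colex d [] = d , here refl , (λ ()) , λ y d<y → mk⇔ (λ ()) (λ { (here refl) → contradiction d<y (<-irrefl refl) })
  inc-<colex d (false ∷ β) = d , here refl , d∉ , agree
    where
    d∉ : ¬ d ∈ℕ toSet (suc d) β
    d∉ p = <-irrefl refl (All.lookup (toSet-≥ (suc d) β) p)
    agree : ∀ y → d < y → y ∈ℕ toSet (suc d) β ⇔ y ∈ℕ (d ∷ toSet (suc d) β)
    agree y d<y = mk⇔ there λ { (here refl) → contradiction d<y (<-irrefl refl) ; (there p) → p }
  inc-<colex d (true ∷ β) with inc-<colex (suc d) β
  ... | x , x∈ , x∉ , agree = x , x∈ ,
        (λ { (here refl) → contradiction d<x (<-irrefl refl) ; (there p) → x∉ p }) ,
        λ y x<y → mk⇔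
          (λ { (here refl) → contradiction (<-trans d<x x<y) (<-irrefl refl)
             ; (there p) → Equivalence.to (agree y x<y) p })
          (there ∘ Equivalence.from (agree y x<y))
    where
    d<x : d < x
    d<x = All.lookup (toSet-≥ (suc d) (inc β)) x∈

  <colex-trans : ∀ {A B C} → A <colex B → B <colex C → A <colex C
  <colex-trans (x , x∈B , x∉A , AB) (z , z∈C , z∉B , BC) with <-cmp x z
  ... | tri< x<z _ _ = z , z∈C , z∉B ∘ Equivalence.to (AB z x<z) ,
        λ y z<y → mk⇔ (Equivalence.to (BC y z<y) ∘ Equivalence.to (AB y (<-trans x<z z<y)))
                      (Equivalence.from (AB y (<-trans x<z z<y)) ∘ Equivalence.from (BC y z<y))
  ... | tri≈ _ refl _ = contradiction x∈B z∉B
  ... | tri> _ _ z<x = x , Equivalence.to (BC x z<x) x∈B , x∉A ,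
        λ y x<y → mk⇔ (Equivalence.to (BC y (<-trans z<x x<y)) ∘ Equivalence.to (AB y x<y))
                      (Equivalence.from (AB y x<y) ∘ Equivalence.from (BC y (<-trans z<x x<y)))

  colexSet : ℕ → List ℕ
  colexSet k = toSet 1 (bits k)

  colexSet-mono : ∀ {j k} → j < k → colexSet j <colex colexSet k
  colexSet-mono = go ∘ ≤⇒≤‴
    where
    go : ∀ {j k} → suc j ≤‴ k → colexSet j <colex colexSet k
    go {j} ≤‴-refl       = inc-<colex 1 (bits j)
    go {j} (≤‴-step j<k) = <colex-trans (inc-<colex 1 (bits j)) (go j<k)

  colexSet-canonical : ∀ k → CanonicalSet (colexSet k)
  colexSet-canonical k = AllPairs⇒Linked (toSet-increasing 1 (bits k)) , toSet-≥ 1 (bits k)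

  colexSet-surjective : ∀ {A} → CanonicalSet A → ∃ λ k → colexSet k ≡ A
  colexSet-surjective (linked , pos)
    with β , refl ← toSet-surjective 1 (Linked⇒AllPairs <-trans linked) pos = bits-surjective 1 β

  colexSets : ℕ → List (List ℕ)
  colexSets zero    = []
  colexSets (suc m) = colexSet m ∷ colexSets m

  ∈-colexSets⁺ : ∀ {k m} → k < m → colexSet k LMem.∈ colexSets m
  ∈-colexSets⁺ {k} {suc m} (s≤s k≤m) with m≤n⇒m<n∨m≡n k≤m
  ... | inj₁ k<m  = there (∈-colexSets⁺ k<m)
  ... | inj₂ refl = here refl

  ∈-colexSets⁻ : ∀ {A m} → A LMem.∈ colexSets m → ∃ λ k → k < m × A ≡ colexSet k
  ∈-colexSets⁻ {m = suc m} (here eq) = m , ≤-refl , eq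
  ∈-colexSets⁻ {m = suc m} (there p) with ∈-colexSets⁻ p
  ... | k , k<m , eq = k , m≤n⇒m≤1+n k<m , eq

  colexSets-unique : ∀ m → Unique (colexSets m)
  colexSets-unique zero    = []
  colexSets-unique (suc m) = All.tabulate fresh ∷ colexSets-unique m
    where
    fresh : ∀ {A} → A LMem.∈ colexSets m → colexSet m ≢ A
    fresh p eq with ∈-colexSets⁻ p
    ... | k , k<m , refl with colexSet-mono k<m
    ... | x , x∈ , x∉ , _ = x∉ (subst (x ∈ℕ_) eq x∈)

  length-colexSets : ∀ m → length (colexSets m) ≡ m
  length-colexSets zero    = refl
  length-colexSets (suc m) = cong suc (length-colexSets m)

  ‖colexSets‖ : ∀ m → ‖ colexSets m ‖ℕ ≡ popSum m
  ‖colexSets‖ zero    = refl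
  ‖colexSets‖ (suc m) = trans (cong₂ _+_ (length-toSet 1 (bits m)) (‖colexSets‖ m)) (+-comm _ (popSum m))

  -- Duplicate-free lists and comparison with the colex initial segment

  sum-map-mono : {X : Set} (f : X → ℕ) {xs ys : List X} → Unique xs →
    (∀ {x} → x LMem.∈ xs → x LMem.∈ ys) → sum (map f xs) ≤ sum (map f ys)
  sum-map-mono f [] _ = z≤n
  sum-map-mono f {x ∷ xs} {ys} (x∉xs ∷ u) xs⊆ys with ∈-∃++ (xs⊆ys (here refl))
  ... | as , bs , refl = subst (f x + sum (map f xs) ≤_) extract
          (+-monoʳ-≤ (f x) (sum-map-mono f u remaining))
    where
    remaining : ∀ {z} → z LMem.∈ xs → z LMem.∈ as ++ bs
    remaining z∈xs with ∈-++⁻ as (xs⊆ys (there z∈xs))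
    ... | inj₁ p           = ∈-++⁺ˡ p
    ... | inj₂ (here refl) = contradiction refl (All.lookup x∉xs z∈xs)
    ... | inj₂ (there p)   = ∈-++⁺ʳ as p
    sum-map-++ : ∀ cs → sum (map f (as ++ cs)) ≡ sum (map f as) + sum (map f cs)
    sum-map-++ cs = trans (cong sum (map-++ f as cs)) (sum-++ (map f as) (map f cs))
    extract : f x + sum (map f (as ++ bs)) ≡ sum (map f (as ++ x ∷ bs))
    extract rewrite sum-map-++ bs | sum-map-++ (x ∷ bs) = swap (f x) (sum (map f as)) _
      where
      swap : ∀ a b c → a + (b + c) ≡ b + (a + c)
      swap = solve-∀

  sum-ones : {X : Set} (xs : List X) → sum (map (λ _ → 1) xs) ≡ length xs
  sum-ones []       = refl
  sum-ones (x ∷ xs) = cong suc (sum-ones xs)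

  length-mono : {X : Set} {xs ys : List X} → Unique xs →
    (∀ {x} → x LMem.∈ xs → x LMem.∈ ys) → length xs ≤ length ys
  length-mono {xs = xs} {ys} u h = subst₂ _≤_ (sum-ones xs) (sum-ones ys) (sum-map-mono (λ _ → 1) u h)

  -- If the set with index k < m were missing from `𝓘`, closure under colex would force every member
  -- of `𝓘` to precede it, which leaves room for only k sets.
  popSum-≤-initial : ∀ {m 𝓘} → IsColexInitial m 𝓘 → popSum m ≤ ‖ 𝓘 ‖ℕ
  popSum-≤-initial {m} {𝓘} (len , unique , canonical , closed) =
    subst (_≤ ‖ 𝓘 ‖ℕ) (‖colexSets‖ m) (sum-map-mono length (colexSets-unique m) initial)
    where
    initial : ∀ {A} → A LMem.∈ colexSets m → A LMem.∈ 𝓘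
    initial p with ∈-colexSets⁻ p
    ... | k , k<m , refl with colexSet k ∈𝓘? 𝓘
    ... | yes q = q
    ... | no ¬q = contradiction
          (≤-<-trans (subst₂ _≤_ len (length-colexSets k) (length-mono unique before)) k<m) (<-irrefl refl)
      where
      before : ∀ {B} → B LMem.∈ 𝓘 → B LMem.∈ colexSets k
      before B∈𝓘 with colexSet-surjective (All.lookup canonical B∈𝓘)
      ... | b , refl with <-cmp b k
      ... | tri< b<k _ _  = ∈-colexSets⁺ b<k
      ... | tri≈ _ refl _ = contradiction B∈𝓘 ¬q
      ... | tri> _ _ k<b  = contradiction (closed _ _ (colexSet-canonical k) B∈𝓘 (colexSet-mono k<b)) ¬q

  -- Families as Boolean functions

  fam : Family n → Fam n
  fam ℬ A = does (A ∈ℱ? ℬ)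

  ∑-single : (g : Subset n → ℕ) (B : Subset n) → (∀ A → A ≢ B → g A ≡ 0) → ∑ g ≡ g B
  ∑-single g [] h = refl
  ∑-single {suc n} g (false ∷ B) h = trans (cong₂ _+_
    (∑-single (g ∘ (false ∷_)) B λ A A≢B → h _ λ { refl → A≢B refl })
    (trans (∑-cong λ A → h (true ∷ A) λ ()) (∑-zero {n}))) (+-identityʳ _)
  ∑-single {suc n} g (true ∷ B) h = cong₂ _+_
    (trans (∑-cong λ A → h (false ∷ A) λ ()) (∑-zero {n}))
    (∑-single (g ∘ (true ∷_)) B λ A A≢B → h _ λ { refl → A≢B refl })

  ∑-fam : (f : Subset n → ℕ) {ℬ : Family n} → Unique ℬ → ∑ (λ A → ind (fam ℬ A) * f A) ≡ sum (map f ℬ)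
  ∑-fam {n} f [] = ∑-zero {n}
  ∑-fam f {B ∷ ℬ} (B∉ℬ ∷ u) = trans
    (trans (∑-cong split) (∑-+ (λ A → ind (is-B A) * f A) (λ A → ind (fam ℬ A) * f A)))
    (cong₂ _+_ single (∑-fam f u))
    where
    is-B : Fam _
    is-B A = does (Vec-≡-dec _≟ᵇ_ A B)

    single : ∑ (λ A → ind (is-B A) * f A) ≡ f B
    single = trans
      (∑-single _ B λ A A≢B → cong (λ b → ind b * f A) (dec-false (Vec-≡-dec _≟ᵇ_ A B) A≢B))
      (trans (cong (λ b → ind b * f B) (dec-true (Vec-≡-dec _≟ᵇ_ B B) refl)) (+-identityʳ (f B)))

    split : ∀ A → ind (fam (B ∷ ℬ) A) * f A ≡ ind (is-B A) * f A + ind (fam ℬ A) * f A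
    split A with Vec-≡-dec _≟ᵇ_ A B
    ... | yes refl rewrite dec-false (B ∈ℱ? ℬ) (λ p → All.lookup B∉ℬ p refl) = sym (+-identityʳ _)
    ... | no A≢B with A ∈ℱ? ℬ
    ... | yes p = refl
    ... | no ¬p = refl

  norm-fam : {ℬ : Family n} → Unique ℬ → norm (fam ℬ) ≡ ‖ ℬ ‖
  norm-fam = ∑-fam ∣_∣

  count-fam : {ℬ : Family n} → Unique ℬ → count (fam ℬ) ≡ length ℬ
  count-fam {ℬ = ℬ} u = trans (∑-cong λ A → sym (*-identityʳ (ind (fam ℬ A))))
    (trans (∑-fam (λ _ → 1) u) (sum-ones ℬ))

  fam⁻ : (ℬ : Family n) {A : Subset n} → fam ℬ ∋ A → A ∈ℱ ℬ
  fam⁻ ℬ {A} = does-true (A ∈ℱ? ℬ)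

  fam⁺ : (ℬ : Family n) {A : Subset n} → A ∈ℱ ℬ → fam ℬ ∋ A
  fam⁺ ℬ {A} = dec-true (A ∈ℱ? ℬ)

  fam-rooted : {ℬ : Family n} → SimplyRooted ℬ → Rooted (fam ℬ)
  fam-rooted {ℬ = ℬ} rooted A p with nonempty? A
  ... | yes A≠∅ with rooted A (fam⁻ ℬ p) A≠∅
  ... | b , b∈A , h = just b , just b∈A , λ { C (just b∈C) C⊆A → fam⁺ ℬ (h C b∈C C⊆A) }
  -- The empty set has no point to be rooted at; it is its own only subset, so it gets the label
  -- `nothing`.
  fam-rooted {ℬ = ℬ} rooted A p | no A=∅ = nothing , nothing , λ C _ C⊆A →
    subst (fam ℬ ∋_) (trans (Empty-unique A=∅) (sym (Empty-unique λ (x , x∈C) → A=∅ (x , C⊆A x∈C)))) p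

  count-rootedAt : {ℬ : Family n} → Unique ℬ → ∀ i → count (rootedAt (fam ℬ) i) ≤ length (ℬ[ ℬ ] i)
  count-rootedAt {ℬ = ℬ} u i = subst (count (rootedAt (fam ℬ) i) ≤_) (count-fam (filter⁺ (RootedAt? ℬ i) u))
    (count-mono λ A p → fam⁺ (ℬ[ ℬ ] i) (member (does-true (rootedBy? (fam ℬ) (just i) A) p)))
    where
    member : ∀ {A} → RootedBy (fam ℬ) (just i) A → A ∈ℱ (ℬ[ ℬ ] i)
    member r@(just i∈A , h) = ∈-filter⁺ (RootedAt? ℬ i) (fam⁻ ℬ (rooted-∋ r))
      (i∈A , λ C i∈C C⊆A → fam⁻ ℬ (h C (just i∈C) C⊆A))

  -- The estimate with denominators cleared, where 1 - p = c / b: the number `z` is 2ⁿ times the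
  -- saving and is at least (1 - p) m² / 4.
  Stable : ℕ → ℕ → ℕ → ℕ → ℕ → Set
  Stable n c b N m = ∃ λ z → 2 ^ n * N + z ≤ 2 ^ n * (popSum m + m) × c * (m * m) ≤ 4 * b * z

  family-stability : {ℬ : Family n} → Unique ℬ → SimplyRooted ℬ → ∀ {a c b} .{{_ : NonZero b}} →
    a + c ≡ b → (∀ i → b * length (ℬ[ ℬ ] i) ≤ a * length ℬ) → Stable n c b (‖ ℬ ‖) (length ℬ)
  family-stability {n} {ℬ} u rooted {a} {c} {b} refl h =
    subst₂ (Stable n c b) (norm-fam u) (count-fam u) (stability (fam ℬ) (fam-rooted rooted) a c density)
    where
    density : ∀ i → b * count (rootedAt (fam ℬ) i) ≤ a * count (fam ℬ)
    density i = ≤-trans (*-monoʳ-≤ b (count-rootedAt u i))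
      (subst (λ k → b * length (ℬ[ ℬ ] i) ≤ a * k) (sym (count-fam u)) (h i))

-- Transfer to rational numbers

open import Data.Nat using (ℕ; _≤_)
open import Data.Fin using (Fin)
open import Data.List using (List; length)
open import Data.List.Relation.Unary.Unique.Propositional using (Unique)
open import Data.Product using (_×_; _,_)
open import Data.Integer using (+_)
open import Data.Rational using (ℚ; 0ℚ; 1ℚ; _+_; _-_; _*_; _/_) renaming (_≤_ to _≤ℚ_)
open import Relation.Binary.PropositionalEquality
  using (_≡_; refl; sym; trans; cong; cong₂; subst; subst₂)
open import Data.Nat as ℕ using (suc)
import Data.Nat.Properties as ℕ
import Data.Nat.Tactic.RingSolver as ℕ-Solver
open import Data.Integer as ℤ using (-[1+_])
import Data.Integer.Properties as ℤ
import Data.Integer.Tactic.RingSolver as ℤ-Solver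
open import Data.Rational as ℚ using (mkℚ; toℚᵘ)
import Data.Rational.Properties as ℚ
open import Data.Rational.Properties
  using (toℚᵘ-homo-*; toℚᵘ-homo-+; toℚᵘ-homo‿-; toℚᵘ-fromℚᵘ; toℚᵘ-cancel-≤; toℚᵘ-mono-≤)
open import Data.Rational.Unnormalised as ℚᵘ using (ℚᵘ; mkℚᵘ; *≤*; _≃_)
import Data.Rational.Unnormalised.Properties as ℚᵘ
open CubeFamilies
  using (popSum; popSum-≤-initial; Stable; family-stability)

*-homo : ∀ {p q p′ q′} → toℚᵘ p ≃ p′ → toℚᵘ q ≃ q′ → toℚᵘ (p * q) ≃ p′ ℚᵘ.* q′
*-homo {p} {q} e f = ℚᵘ.≃-trans (toℚᵘ-homo-* p q) (ℚᵘ.*-cong e f)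

+-homo : ∀ {p q p′ q′} → toℚᵘ p ≃ p′ → toℚᵘ q ≃ q′ → toℚᵘ (p + q) ≃ p′ ℚᵘ.+ q′
+-homo {p} {q} e f = ℚᵘ.≃-trans (toℚᵘ-homo-+ p q) (ℚᵘ.+-cong e f)

minus-homo : ∀ {p q p′ q′} → toℚᵘ p ≃ p′ → toℚᵘ q ≃ q′ → toℚᵘ (p - q) ≃ p′ ℚᵘ.- q′
minus-homo {p} {q} e f = +-homo e (ℚᵘ.≃-trans (toℚᵘ-homo‿- q) (ℚᵘ.-‿cong f))

fraction : ∀ k d → toℚᵘ ((+ k) / suc d) ≃ mkℚᵘ (+ k) d
fraction k d = toℚᵘ-fromℚᵘ (mkℚᵘ (+ k) d)

private
  ι : ℕ → ℚᵘ
  ι k = mkℚᵘ (+ k) 0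

-- The shape of gain-ℤ and scaled-ℤ is that of the comparisons of numerators to which _≤_ on ℚᵘ unfolds.

gain-ℤ : ∀ a c b m z → a ℕ.+ c ≡ b → c ℕ.* (m ℕ.* m) ℕ.≤ 4 ℕ.* b ℕ.* z →
  ((+ m ℤ.* + m) ℤ.* (+ 1 ℤ.* + (b ℕ.* b ℕ.* 12) ℤ.+ ℤ.- (+ a ℤ.* + a ℤ.* + 1) ℤ.* + 12)) ℤ.* + 1
    ℤ.≤ + z ℤ.* + (1 ℕ.* 1 ℕ.* (12 ℕ.* (b ℕ.* b ℕ.* 12)))
gain-ℤ a c b m z refl h = begin
  ((+ m ℤ.* + m) ℤ.* (+ 1 ℤ.* + (b ℕ.* b ℕ.* 12) ℤ.+ ℤ.- (+ a ℤ.* + a ℤ.* + 1) ℤ.* + 12)) ℤ.* + 1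
    ≡⟨ cong (λ k → ((+ m ℤ.* + m) ℤ.* (+ 1 ℤ.* k ℤ.+ ℤ.- (+ a ℤ.* + a ℤ.* + 1) ℤ.* + 12)) ℤ.* + 1)
         (trans (ℤ.pos-* (b ℕ.* b) 12) (cong (ℤ._* + 12) (ℤ.pos-* b b))) ⟩
  ((+ m ℤ.* + m) ℤ.* (+ 1 ℤ.* (+ b ℤ.* + b ℤ.* + 12) ℤ.+ ℤ.- (+ a ℤ.* + a ℤ.* + 1) ℤ.* + 12)) ℤ.* + 1
    -- With b = a + c, the difference b² - a² factors as c (2a + c).
    ≡⟨ factor (+ a) (+ c) (+ m) ⟩
  + 12 ℤ.* (+ a ℤ.+ + a ℤ.+ + c) ℤ.* (+ c ℤ.* (+ m ℤ.* + m))
    ≡⟨ sym (trans (ℤ.pos-* (12 ℕ.* (a ℕ.+ a ℕ.+ c)) (c ℕ.* (m ℕ.* m))) (cong₂ ℤ._*_ (ℤ.pos-* 12 (a ℕ.+ a ℕ.+ c))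
         (trans (ℤ.pos-* c (m ℕ.* m)) (cong (+ c ℤ.*_) (ℤ.pos-* m m))))) ⟩
  + (12 ℕ.* (a ℕ.+ a ℕ.+ c) ℕ.* (c ℕ.* (m ℕ.* m)))
    ≤⟨ ℤ.+≤+ bound ⟩
  + (z ℕ.* (1 ℕ.* 1 ℕ.* (12 ℕ.* (b ℕ.* b ℕ.* 12))))
    ≡⟨ ℤ.pos-* z _ ⟩
  + z ℤ.* + (1 ℕ.* 1 ℕ.* (12 ℕ.* (b ℕ.* b ℕ.* 12))) ∎
  where
  open ℤ.≤-Reasoning
  factor : ∀ a c m →
    ((m ℤ.* m) ℤ.* (+ 1 ℤ.* ((a ℤ.+ c) ℤ.* (a ℤ.+ c) ℤ.* + 12) ℤ.+ ℤ.- (a ℤ.* a ℤ.* + 1) ℤ.* + 12)) ℤ.* + 1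
      ≡ + 12 ℤ.* (a ℤ.+ a ℤ.+ c) ℤ.* (c ℤ.* (m ℤ.* m))
  factor = ℤ-Solver.solve-∀
  -- Since 2a + c = b (1 + p), the estimate 2a + c ≤ 3b says 1 + p ≤ 3, and this turns (1 - p) / 4
  -- into (1 - p²) / 12.
  bound : 12 ℕ.* (a ℕ.+ a ℕ.+ c) ℕ.* (c ℕ.* (m ℕ.* m)) ℕ.≤ z ℕ.* (1 ℕ.* 1 ℕ.* (12 ℕ.* (b ℕ.* b ℕ.* 12)))
  bound = ℕ.≤-trans (ℕ.*-mono-≤ (ℕ.*-monoʳ-≤ 12 2a+c≤3b) h) (ℕ.≤-reflexive (collect b z))
    where
    2a+c≤3b : a ℕ.+ a ℕ.+ c ℕ.≤ 3 ℕ.* b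
    2a+c≤3b = subst (a ℕ.+ a ℕ.+ c ℕ.≤_) (expand a c) (ℕ.m≤m+n _ _)
      where
      expand : ∀ a c → a ℕ.+ a ℕ.+ c ℕ.+ (a ℕ.+ c ℕ.+ c) ≡ 3 ℕ.* (a ℕ.+ c)
      expand = ℕ-Solver.solve-∀
    collect : ∀ b z → 12 ℕ.* (3 ℕ.* b) ℕ.* (4 ℕ.* b ℕ.* z) ≡ z ℕ.* (1 ℕ.* 1 ℕ.* (12 ℕ.* (b ℕ.* b ℕ.* 12)))
    collect = ℕ-Solver.solve-∀

gain-≤ : ∀ p {a c d m z} → toℚᵘ p ≡ mkℚᵘ (+ a) d → a ℕ.+ c ≡ suc d →
  c ℕ.* (m ℕ.* m) ℕ.≤ 4 ℕ.* suc d ℕ.* z →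
  (+ m) / 1 * ((+ m) / 1) * ((+ 1) / 12 - p * p * ((+ 1) / 12)) ≤ℚ (+ z) / 1
gain-≤ p {a} {c} {d} {m} {z} p≡ a+c h = toℚᵘ-cancel-≤
  (ℚᵘ.≤-respˡ-≃ (ℚᵘ.≃-sym expand) (ℚᵘ.≤-respʳ-≃ (ℚᵘ.≃-sym (fraction z 0)) (*≤* (gain-ℤ a c (suc d) m z a+c h))))
  where
  p≃ : toℚᵘ p ≃ mkℚᵘ (+ a) d
  p≃ = ℚᵘ.≃-reflexive p≡
  expand : toℚᵘ ((+ m) / 1 * ((+ m) / 1) * ((+ 1) / 12 - p * p * ((+ 1) / 12)))
    ≃ ι m ℚᵘ.* ι m ℚᵘ.* (mkℚᵘ (+ 1) 11 ℚᵘ.- mkℚᵘ (+ a) d ℚᵘ.* mkℚᵘ (+ a) d ℚᵘ.* mkℚᵘ (+ 1) 11)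
  expand = *-homo (*-homo (fraction m 0) (fraction m 0))
    (minus-homo (fraction 1 11) (*-homo (*-homo p≃ p≃) (fraction 1 11)))

scaled-ℤ : ∀ N z E M P → P ℕ.* N ℕ.+ z ℕ.≤ P ℕ.* (E ℕ.+ M) →
  (+ N ℤ.* + (1 ℕ.* P) ℤ.+ (+ z ℤ.* + 1) ℤ.* + 1) ℤ.* + 1
    ℤ.≤ (+ E ℤ.* + 1 ℤ.+ + M ℤ.* + 1) ℤ.* + (1 ℕ.* (1 ℕ.* P))
scaled-ℤ N z E M P h rewrite ℕ.*-identityˡ P | ℕ.*-identityˡ P = begin
  (+ N ℤ.* + P ℤ.+ (+ z ℤ.* + 1) ℤ.* + 1) ℤ.* + 1 ≡⟨ left (+ N) (+ z) (+ P) ⟩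
  + P ℤ.* + N ℤ.+ + z                             ≡⟨ cong (ℤ._+ + z) (ℤ.pos-* P N) ⟨
  + (P ℕ.* N ℕ.+ z)                               ≤⟨ ℤ.+≤+ h ⟩
  + (P ℕ.* (E ℕ.+ M))                             ≡⟨ ℤ.pos-* P (E ℕ.+ M) ⟩
  + P ℤ.* (+ E ℤ.+ + M)                           ≡⟨ right (+ E) (+ M) (+ P) ⟩
  (+ E ℤ.* + 1 ℤ.+ + M ℤ.* + 1) ℤ.* + P           ∎
  where
  open ℤ.≤-Reasoning
  left : ∀ N z P → (N ℤ.* P ℤ.+ (z ℤ.* + 1) ℤ.* + 1) ℤ.* + 1 ≡ P ℤ.* N ℤ.+ z
  left = ℤ-Solver.solve-∀
  right : ∀ E M P → P ℤ.* (E ℤ.+ M) ≡ (E ℤ.* + 1 ℤ.+ M ℤ.* + 1) ℤ.* P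
  right = ℤ-Solver.solve-∀

module _ (n : ℕ) where

  private instance
    2^n≢0 : ℕ.NonZero (2 ℕ.^ n)
    2^n≢0 = ℕ.m^n≢0 2 n

  inv2^-nonNeg : ℚ.NonNegative (inv2^ n)
  inv2^-nonNeg = ℚ.normalize-nonNeg 1 (2 ℕ.^ n)

  inv2^≃ : toℚᵘ (inv2^ n) ≃ (+ 1) ℚᵘ./ (2 ℕ.^ n)
  inv2^≃ with 2 ℕ.^ n | 2^n≢0
  ... | suc k | _ = fraction 1 k

  scaled-≤ : ∀ N z E M → 2 ℕ.^ n ℕ.* N ℕ.+ z ℕ.≤ 2 ℕ.^ n ℕ.* (E ℕ.+ M) →
    (+ N) / 1 + (+ z) / 1 * inv2^ n ≤ℚ (+ E) / 1 + (+ M) / 1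
  scaled-≤ N z E M h = toℚᵘ-cancel-≤ (ℚᵘ.≤-respˡ-≃ (ℚᵘ.≃-sym (+-homo (fraction N 0) (*-homo (fraction z 0) inv2^≃)))
    (ℚᵘ.≤-respʳ-≃ (ℚᵘ.≃-sym (+-homo (fraction E 0) (fraction M 0))) (unnormalised (2 ℕ.^ n) h)))
    where
    -- A general `P` replaces 2ⁿ, so that matching it with a successor lets the division by `P`
    -- compute.
    unnormalised : ∀ P .{{_ : ℕ.NonZero P}} → P ℕ.* N ℕ.+ z ℕ.≤ P ℕ.* (E ℕ.+ M) →
      ι N ℚᵘ.+ ι z ℚᵘ.* ((+ 1) ℚᵘ./ P) ℚᵘ.≤ ι E ℚᵘ.+ ι M
    unnormalised (suc k) h = *≤* (scaled-ℤ N z E M (suc k) h)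

  -- The saving moves to the right-hand side, where `z` may be lowered to `K` because the factor
  -- `inv2^ n` is nonnegative.
  subtract-gain : ∀ {N K R} z → K ≤ℚ (+ z) / 1 → N + (+ z) / 1 * inv2^ n ≤ℚ R → N ≤ℚ R - K * inv2^ n
  subtract-gain {N} {K} {R} z K≤z h = begin
    N                                     ≡⟨ ℚ.+-identityʳ N ⟨
    N + 0ℚ                                ≡⟨ cong (λ q → N + q) (ℚ.+-inverseʳ Z) ⟨
    N + (Z - Z)                           ≡⟨ ℚ.+-assoc N Z _ ⟨
    N + Z - Z                             ≤⟨ ℚ.+-mono-≤ h (ℚ.neg-antimono-≤ (ℚ.*-monoʳ-≤-nonNeg (inv2^ n) K≤z)) ⟩
    R - K * inv2^ n                       ∎
    where
    open ℚ.≤-Reasoning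
    instance _ = inv2^-nonNeg
    Z = (+ z) / 1 * inv2^ n

rational-bound : ∀ n p {a c d} → toℚᵘ p ≡ mkℚᵘ (+ a) d → a ℕ.+ c ≡ suc d → ∀ N E m z →
  2 ℕ.^ n ℕ.* N ℕ.+ z ≤ 2 ℕ.^ n ℕ.* (E ℕ.+ m) → c ℕ.* (m ℕ.* m) ≤ 4 ℕ.* suc d ℕ.* z →
  (+ N) / 1 ≤ℚ ((+ E) / 1 + (+ m) / 1)
    - ((+ m) / 1) * ((+ m) / 1) * ((+ 1) / 12 - p * p * ((+ 1) / 12)) * inv2^ n
rational-bound n p {c = c} p≡ a+c≡b N E m z norm-≤ z-≥ =
  subtract-gain n z (gain-≤ p {c = c} {m = m} {z} p≡ a+c≡b z-≥) (scaled-≤ n N z E m norm-≤)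

bound-ℕ : ∀ {a d} p → toℚᵘ p ≡ mkℚᵘ (+ a) d → ∀ k m → (+ k) / 1 ≤ℚ p * ((+ m) / 1) →
  suc d ℕ.* k ≤ a ℕ.* m
bound-ℕ {a} {d} p p≡ k m h
  with ℚᵘ.*≤* k≤ ← ℚᵘ.≤-respˡ-≃ (fraction k 0)
         (ℚᵘ.≤-respʳ-≃ (*-homo (ℚᵘ.≃-reflexive p≡) (fraction m 0)) (toℚᵘ-mono-≤ h)) =
  ℤ.drop‿+≤+ (subst₂ ℤ._≤_ left right k≤)
  where
  left : + k ℤ.* + (suc d ℕ.* 1) ≡ + (suc d ℕ.* k)
  left = trans (sym (ℤ.pos-* k (suc d ℕ.* 1)))
    (cong +_ (trans (cong (k ℕ.*_) (ℕ.*-identityʳ (suc d))) (ℕ.*-comm k (suc d))))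
  right : + a ℤ.* + m ℤ.* + 1 ≡ + (a ℕ.* m)
  right = trans (ℤ.*-identityʳ (+ a ℤ.* + m)) (sym (ℤ.pos-* a m))

theorem8 : (n : ℕ) → 1 ≤ n → (ℬ : Family n) → Unique ℬ → SimplyRooted ℬ →
    (m : ℕ) → length ℬ ≡ m → (p : ℚ) → 0ℚ ≤ℚ p → p ≤ℚ 1ℚ →
    ((i : Fin n) → (+ length (ℬ[ ℬ ] i)) / 1 ≤ℚ p * ((+ m) / 1)) →
    (𝓘 : List (List ℕ)) → IsColexInitial m 𝓘 →
    (+ ‖ ℬ ‖) / 1 ≤ℚ ((+ ‖ 𝓘 ‖ℕ) / 1 + (+ m) / 1)
      - ((+ m) / 1) * ((+ m) / 1) * ((+ 1) / 12 - p * p * ((+ 1) / 12)) * inv2^ n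
theorem8 n _ ℬ unique rooted m refl (mkℚ -[1+ _ ] _ _) (ℚ.*≤* ()) p≤1 bound 𝓘 initial
theorem8 n _ ℬ unique rooted m refl p@(mkℚ (+ a) d _) 0≤p (ℚ.*≤* p≤1) bound 𝓘 initial =
  finish (family-stability unique rooted {a} {c} a+c≡b λ i → bound-ℕ p refl (length (ℬ[ ℬ ] i)) m (bound i))
  where
  -- The numerator of 1 - p over the denominator `suc d`; the truncated subtraction is exact because
  -- p ≤ 1.
  c = suc d ℕ.∸ a

  a+c≡b : a ℕ.+ c ≡ suc d
  a+c≡b = ℕ.m+[n∸m]≡n
    (ℤ.drop‿+≤+ (subst₂ ℤ._≤_ (ℤ.*-identityʳ (+ a)) (ℤ.*-identityˡ (+ suc d)) p≤1))

  finish : Stable n c (suc d) (‖ ℬ ‖) m → (+ ‖ ℬ ‖) / 1 ≤ℚ ((+ ‖ 𝓘 ‖ℕ) / 1 + (+ m) / 1)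
    - ((+ m) / 1) * ((+ m) / 1) * ((+ 1) / 12 - p * p * ((+ 1) / 12)) * inv2^ n
  finish (z , norm-≤ , z-≥) = rational-bound n p refl a+c≡b (‖ ℬ ‖) (‖ 𝓘 ‖ℕ) m z
    (ℕ.≤-trans norm-≤ (ℕ.*-monoʳ-≤ (2 ℕ.^ n) (ℕ.+-monoˡ-≤ m (popSum-≤-initial initial)))) z-≥
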